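{- There are exactly two $1$-Wilf-equivalence classes for (classical) patterns of length three, namely $\{123,132\}$ and $\{321,312,213,231\}$. For every integer $r\ge2$, there are exactly three $r$-Wilf-equivalence classes for patterns of length three, namely $\{213,231\}$, $\{123,132\}$ and $\{321,312\}$.
   Context: $S_n$ is the set of permutations of $\{1,\ldots,n\}$ written as sequences $(\tau(1),\ldots,\tau(n))$. A permutation $\tau\in S_n$ contains $\sigma\in S_k$ as a pattern if there are indices $1\le i_1<\cdots<i_k\le n$ such that for all $1\le a<b\le k$, $\tau(i_a)<\tau(i_b)$ if and only if $\sigma(a)<\sigma(b)$; otherwise $\tau$ avoids $\sigma$. For $1\le r\le n$, $S_{n,r}(\sigma)$ is the set of $\tau\in S_n$ with $\tau(1)=r$ that avoid $\sigma$. For a fixed $r\in\{1,2,\ldots\}$, two patterns $\sigma,\sigma'$ are $r$-Wilf equivalent if $|S_{n,r}(\sigma)|=|S_{n,r}(\sigma')|$ for all $n\ge r$. The patterns of length three are the six elements of $S_3$. -}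

module Defs where

open import Data.Fin.Base using (Fin; zero; suc; toℕ; finToFun; funToFin)
import Data.Fin.Base as Fin
import Data.Fin.Properties as Fin
open import Data.Fin.Permutation
  using (Permutation′; _⟨$⟩ʳ_; _≈_; id; insert; remove; insert-remove; insert-punchIn)
open import Data.List.Base
  using (List; []; _∷_; allFin; cartesianProductWith; filter; head; length; tabulate)
open import Data.List.Membership.Propositional using (_∈_)
open import Data.List.Membership.Propositional.Properties using (∈-allFin)
import Data.List.Membership.Setoid.Properties as SetoidMembership
open import Data.List.Relation.Unary.All using (All; [])
open import Data.List.Relation.Unary.AllPairs using (AllPairs; []; _∷_)
open import Data.List.Relation.Unary.Any using (Any; here)
open import Data.List.Relation.Unary.Unique.Propositional.Properties using (allFin⁺)
import Data.List.Relation.Unary.Unique.Setoid.Properties as SetoidUnique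
open import Data.Maybe.Base using (just)
import Data.Maybe.Properties as Maybe
open import Data.Nat.Base using (ℕ; zero; suc; _^_; _≤_)
import Data.Nat.Properties as ℕ
open import Data.Product.Base using (_×_; _,_; ∃-syntax)
open import Function.Bundles using (_⇔_; mk⇔; Equivalence)
open import Level using (0ℓ)
open import Relation.Binary.Bundles using (Setoid)
open import Relation.Binary.Core using (Rel; _Preserves_⟶_)
open import Relation.Binary.PropositionalEquality
  using (_≡_; refl; sym; trans; cong; subst₂; setoid)
open import Relation.Nullary using (¬_; Dec)
open import Relation.Nullary.Decidable using (map′; _×-dec_; _→-dec_; ¬?)
open import Relation.Unary using (Pred; Decidable; _≐_)

private
  variable
    k l n : ℕ

-- The word (τ(1), …, τ(n)), with values in {1, …, n}.  (Fin n itself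
-- counts from 0.)
oneLine : Permutation′ n → List ℕ
oneLine τ = tabulate (λ i → suc (toℕ (τ ⟨$⟩ʳ i)))

IsOccurrence : Permutation′ k → Permutation′ n → (Fin k → Fin n) → Set
IsOccurrence σ τ ι =
  ι Preserves Fin._<_ ⟶ Fin._<_ ×
  (∀ a b → a Fin.< b →
     (τ ⟨$⟩ʳ ι a) Fin.< (τ ⟨$⟩ʳ ι b) ⇔ (σ ⟨$⟩ʳ a) Fin.< (σ ⟨$⟩ʳ b))

Contains : Permutation′ n → Permutation′ k → Set
Contains τ σ = ∃[ ι ] IsOccurrence σ τ ι

Avoids : Permutation′ n → Permutation′ k → Set
Avoids τ σ = ¬ Contains τ σ

-- Membership in S_{n,r}(σ).
InS : (n r : ℕ) → Permutation′ k → Pred (Permutation′ n) 0ℓ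
InS n r σ τ = head (oneLine τ) ≡ just r × Avoids τ σ

isOccurrence? : (σ : Permutation′ k) (τ : Permutation′ n) →
                Decidable (IsOccurrence σ τ)
isOccurrence? σ τ ι =
  map′ (λ f {a} {b} → f a b) (λ f a b → f {a} {b})
    (Fin.all? λ a → Fin.all? λ b → (a Fin.<? b) →-dec (ι a Fin.<? ι b))
  ×-dec
  (Fin.all? λ a → Fin.all? λ b → (a Fin.<? b) →-dec
    (((τ ⟨$⟩ʳ ι a) Fin.<? (τ ⟨$⟩ʳ ι b)) ⇔? ((σ ⟨$⟩ʳ a) Fin.<? (σ ⟨$⟩ʳ b))))
  where
  _⇔?_ : {A B : Set} → Dec A → Dec B → Dec (A ⇔ B)
  a? ⇔? b? = map′ (λ (f , g) → mk⇔ f g)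
                  (λ e → Equivalence.to e , Equivalence.from e)
                  ((a? →-dec b?) ×-dec (b? →-dec a?))

contains? : (τ : Permutation′ n) (σ : Permutation′ k) → Dec (Contains τ σ)
contains? {n} {k} τ σ =
  map′ (λ (j , occ) → finToFun j , occ)
       (λ (ι , occ) → funToFin ι , respects (λ i → sym (Fin.finToFun-funToFin ι i)) occ)
       (Fin.any? {n = n ^ k} λ j → isOccurrence? σ τ (finToFun j))
  where
  respects : ∀ {ι κ} → (∀ i → ι i ≡ κ i) → IsOccurrence σ τ ι → IsOccurrence σ τ κ
  respects eq (mono , iso) =
    (λ {a} {b} a<b → subst₂ Fin._<_ (eq a) (eq b) (mono a<b)) ,
    (λ a b a<b → subst₂ (λ x y → (τ ⟨$⟩ʳ x) Fin.< (τ ⟨$⟩ʳ y) ⇔ _)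
                        (eq a) (eq b) (iso a b a<b))

inS? : (n r : ℕ) (σ : Permutation′ k) → Decidable (InS n r σ)
inS? n r σ τ = Maybe.≡-dec ℕ._≟_ (head (oneLine τ)) (just r) ×-dec ¬? (contains? τ σ)

-- All elements of S_n: choose τ(1), then arrange the other values by a
-- permutation of n - 1.  Each permutation is listed exactly once up to _≈_;
-- see permutations-complete and permutations-unique.
permutations : ∀ n → List (Permutation′ n)
permutations zero    = id ∷ []
permutations (suc n) = cartesianProductWith (insert zero) (allFin (suc n)) (permutations n)

permutationSetoid : ℕ → Setoid 0ℓ 0ℓ
permutationSetoid n = record
  { Carrier       = Permutation′ n
  ; _≈_           = _≈_
  ; isEquivalence = record
    { refl  = λ _ → refl
    ; sym   = λ p i → sym (p i)
    ; trans = λ p q i → trans (p i) (q i)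
    }
  }

insert-cong : ∀ {i j} {π ρ : Permutation′ n} → i ≡ j → π ≈ ρ →
              insert zero i π ≈ insert zero j ρ
insert-cong refl p zero    = refl
insert-cong refl p (suc m) = cong (Fin.punchIn _) (p m)

insert-injective : ∀ {i j} {π ρ : Permutation′ n} →
                   insert zero i π ≈ insert zero j ρ → i ≡ j × π ≈ ρ
insert-injective {i = i} p with refl ← p zero =
  refl , λ m → Fin.punchIn-injective i _ _ (p (suc m))

permutations-complete : ∀ n (τ : Permutation′ n) → Any (τ ≈_) (permutations n)
permutations-complete zero    τ = here λ ()
permutations-complete (suc n) τ =
  SetoidMembership.∈-resp-≈ (permutationSetoid (suc n)) {x = insert zero i π} {y = τ}
    (insert-remove zero τ)
    (SetoidMembership.∈-cartesianProductWith⁺ (setoid (Fin (suc n))) (permutationSetoid n)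
      (permutationSetoid (suc n)) {f = insert zero}
      (λ {i} {j} {π} {ρ} → insert-cong {i = i} {j} {π} {ρ}) {a = i} {b = π}
      (∈-allFin i) (permutations-complete n π))
  where
  i = τ ⟨$⟩ʳ zero
  π = remove zero τ

permutations-unique : ∀ n → AllPairs (λ π ρ → ¬ π ≈ ρ) (permutations n)
permutations-unique zero    = [] ∷ []
permutations-unique (suc n) =
  SetoidUnique.cartesianProductWith⁺ (setoid (Fin (suc n))) (permutationSetoid n)
    (permutationSetoid (suc n)) (insert zero)
    (λ {i} {j} {π} {ρ} → insert-injective {i = i} {j} {π} {ρ})
    (allFin⁺ (suc n)) (permutations-unique n)

-- |S_{n,r}(σ)|
cardS : (n r : ℕ) → Permutation′ k → ℕ
cardS n r σ = length (filter (inS? n r σ) (permutations n))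

WilfEquivalent : ℕ → Permutation′ k → Permutation′ l → Set
WilfEquivalent r σ σ′ = ∀ n → r ≤ n → cardS n r σ ≡ cardS n r σ′

IsClass : {A : Set} → Rel A 0ℓ → Pred A 0ℓ → Set
IsClass _~_ C = ∃[ x ] C ≐ (x ~_)

-- The equivalence classes of _~_ are precisely the listed predicates, and
-- these are pairwise different, so that there are exactly length Cs classes.
ClassesAre : {A : Set} → Rel A 0ℓ → List (Pred A 0ℓ) → Set₁
ClassesAre _~_ Cs =
  All (IsClass _~_) Cs ×
  (∀ C → IsClass _~_ C → Any (C ≐_) Cs) ×
  AllPairs (λ C D → ¬ (C ≐ D)) Cs

-- The set of permutations with the given one-line notations.
⟦_⟧ : List (List ℕ) → Pred (Permutation′ n) 0ℓ
⟦ ws ⟧ σ = oneLine σ ∈ ws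

p123 p132 p213 p231 p312 p321 : List ℕ
p123 = 1 ∷ 2 ∷ 3 ∷ []
p132 = 1 ∷ 3 ∷ 2 ∷ []
p213 = 2 ∷ 1 ∷ 3 ∷ []
p231 = 2 ∷ 3 ∷ 1 ∷ []
p312 = 3 ∷ 1 ∷ 2 ∷ []
p321 = 3 ∷ 2 ∷ 1 ∷ []

{-# OPTIONS --safe #-}

-- Write a permutation as i π, where i is its first letter and π is the rest, standardised.
--
-- 123 and 132: let s be the first letter of π.  If s < i, then i π avoids the pattern iff π
-- does.  Otherwise s must be i for 132, and again i π avoids 132 iff π does, whereas s must be
-- the maximum for 123, where it is inert and can be deleted, which leaves an avoider starting
-- with i.  So both refined counts satisfy the same recurrence.  Complementing gives 321 and 312.
--
-- 213 and 231: i π avoids 213 iff π does and the values of π above i precede those below i.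
-- The reversal of π is then a direct sum, split at i, that avoids 312, so its inverse is a
-- direct sum, split at i, that avoids 231; these are exactly the π for which i π avoids 231.
-- For r = 1 the first letter is inert in 213, 231, 312 and 321, and reversal exchanges 213
-- and 312.
--
-- For r ≥ 2 the patterns 213 and 132 are separated at n = r + 1, where the counts are the
-- Catalan numbers C(r-1) and C(r).  For r ≥ 3 both are separated from 321 at n = r, where only
-- one permutation avoids 321; for r = 2 this happens at n = 3 and n = 4.
module Submission where

open import Defs
open import Data.Bool.Base using (true; false)
open import Data.Fin.Base
  using (Fin; zero; suc; toℕ; fromℕ; inject₁; inject≤; fromℕ<; opposite; punchIn)
import Data.Fin.Base as Fin
open import Data.Fin.Induction using (<-weakInduction)
open import Data.Fin.Patterns using (0F; 1F; 2F)
open import Data.Fin.Permutation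
  using (Permutation′; _⟨$⟩ʳ_; _⟨$⟩ˡ_; _≈_; _∘ₚ_; id; flip; reverse; insert; remove;
         insert-remove; inverseˡ; inverseʳ; transpose)
import Data.Fin.Permutation.Components as Components
import Data.Fin.Properties as Fin
open import Data.Fin.Relation.Unary.Top using (View; view; ‵fromℕ; ‵inject₁)
open import Data.List.Base
  using (List; []; _∷_; _++_; map; length; filter; lookup; tabulate; cartesianProductWith)
open import Data.List.Membership.Propositional using (_∈_)
open import Data.List.Membership.Propositional.Properties using (∈-lookup)
import Data.List.Membership.Setoid as Membership
open import Data.List.Membership.Setoid.Properties using (index-injective; ∈-filter⁺)
open import Data.List.Properties
  using (filter-++; filter-none; filter-≐; length-++; length-map; tabulate-cong;
         ∷-injectiveˡ; ∷-injectiveʳ)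
open import Data.List.Relation.Binary.Pointwise as Pointwise using (Pointwise; []; _∷_)
open import Data.List.Relation.Unary.All as All using (All; []; _∷_)
import Data.List.Relation.Unary.All.Properties as All
open import Data.List.Relation.Unary.AllPairs using (AllPairs; []; _∷_)
import Data.List.Relation.Unary.AllPairs.Properties as AllPairs
open import Data.List.Relation.Unary.Any using (Any; here; there)
import Data.List.Relation.Unary.Any.Properties as Any
open import Data.List.Relation.Unary.Unique.Setoid using (Unique)
open import Data.Maybe.Base using (just)
open import Data.Maybe.Properties using (just-injective)
open import Data.Nat.Base using (ℕ; zero; suc; _+_; _≤_; _<_; s≤s; z≤n; z<s; s<s; s<s⁻¹; s≤s⁻¹)
import Data.Nat.Properties as ℕ
open import Data.Product.Base using (_×_; _,_; proj₂; ∃-syntax)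
open import Data.Sum.Base using (_⊎_; inj₁; inj₂; [_,_]′)
open import Function.Base using (_∘_)
open import Function.Bundles using (_⇔_; mk⇔; Equivalence)
open import Level using (0ℓ)
open import Relation.Binary.Bundles using (Setoid)
open import Relation.Binary.Core using (Rel; _Preserves_⟶_)
open import Relation.Binary.Definitions using (_Respects_; Tri; tri<; tri≈; tri>)
open import Relation.Binary.PropositionalEquality
  using (_≡_; _≢_; refl; sym; trans; cong; cong₂; subst; subst₂; module ≡-Reasoning)
open import Relation.Binary.Structures using (IsEquivalence)
open import Relation.Nullary using (Dec; yes; no; ¬_; contradiction)
open import Relation.Nullary.Decidable using (does; ¬?; dec-true; dec-false)
open import Relation.Unary using (Pred; Decidable; _≐_)
open import Algebra.Properties.CommutativeMonoid.Sum ℕ.+-0-commutativeMonoid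
  using (sum; sum-cong-≗; sum-permute)

open Equivalence using (to; from)

private variable
  k l m n r : ℕ
  σ : Permutation′ 3

-- Counting permutations

module _ (S : Setoid 0ℓ 0ℓ) where
  open Setoid S renaming (_≈_ to _∼_; refl to ∼-refl; sym to ∼-sym)
  open Membership S using () renaming (_∈_ to _∈ₛ_)

  lookup-injective : ∀ {xs} → Unique S xs → ∀ i j → lookup xs i ∼ lookup xs j → i ≡ j
  lookup-injective (x! ∷ xs!) zero    zero    eq = refl
  lookup-injective (x! ∷ xs!) zero    (suc j) eq = contradiction eq (All.lookup x! (∈-lookup j))
  lookup-injective (x! ∷ xs!) (suc i) zero    eq =
    contradiction (∼-sym eq) (All.lookup x! (∈-lookup i))
  lookup-injective (x! ∷ xs!) (suc i) (suc j) eq = cong suc (lookup-injective xs! i j eq)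

  -- Pigeonhole: sending a position of `xs` to the position in `ys` where its entry is found is
  -- injective, because equal positions in `ys` force equivalent entries of `xs`.
  unique-⊆⇒length-≤ : ∀ {xs ys} → Unique S xs → All (_∈ₛ ys) xs → length xs ≤ length ys
  unique-⊆⇒length-≤ xs! xs⊆ys = Fin.injective⇒≤ λ {i} {j} eq →
    lookup-injective xs! i j
      (index-injective S (All.lookup xs⊆ys (∈-lookup i)) (All.lookup xs⊆ys (∈-lookup j)) eq)

count : {P : Pred (Permutation′ n) 0ℓ} → Decidable P → ℕ
count {n} P? = length (filter P? (permutations n))

module _ {Q : Pred (Permutation′ n) 0ℓ} (Q? : Decidable Q) (resp : Q Respects _≈_) where

  -- Source of all lower bounds on counts. The enumeration contains a permutation only up to `_≈_`,
  -- so `Q` has to respect `_≈_` for the listed copy to survive the filter.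
  length≤count : ∀ {xs} → AllPairs (λ π ρ → ¬ π ≈ ρ) xs → All Q xs → length xs ≤ count Q?
  length≤count xs! Qxs = unique-⊆⇒length-≤ (permutationSetoid n) xs!
    (All.map (λ {π} → ∈-filter⁺ (permutationSetoid n) Q? (λ {π} {ρ} → resp {π} {ρ})
                         (permutations-complete n π)) Qxs)

module _ {P : Pred (Permutation′ m) 0ℓ} {Q : Pred (Permutation′ n) 0ℓ}
         (P? : Decidable P) (Q? : Decidable Q) (resp : Q Respects _≈_)
         (f : Permutation′ m → Permutation′ n) (f-pres : ∀ π → P π → Q (f π))
         (f-inj : ∀ π ρ → P π → P ρ → f π ≈ f ρ → π ≈ ρ) where

  private
    image : List (Permutation′ n)
    image = map f (filter P? (permutations m))

    length-image : length image ≡ count P?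
    length-image = length-map f (filter P? (permutations m))

    all-filter : All P (filter P? (permutations m))
    all-filter = All.all-filter P? (permutations m)

    image-unique : AllPairs (λ π ρ → ¬ π ≈ ρ) image
    image-unique = AllPairs.map⁺
      (go all-filter (AllPairs.filter⁺ P? (permutations-unique m)))
      where
      go : ∀ {xs} → All P xs → AllPairs (λ π ρ → ¬ π ≈ ρ) xs →
           AllPairs (λ π ρ → ¬ f π ≈ f ρ) xs
      go []         []         = []
      go (px ∷ pxs) (x! ∷ xs!) =
        All.zipWith (λ {ρ} (pρ , x≉ρ) fx≈fρ → x≉ρ (f-inj _ ρ px pρ fx≈fρ)) (pxs , x!)
        ∷ go pxs xs!

    image-Q : All Q image
    image-Q = All.map⁺ (All.map (λ {π} → f-pres π) all-filter)

  count-≤ : count P? ≤ count Q?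
  count-≤ = subst (_≤ count Q?) length-image
    (length≤count Q? (λ {π} {ρ} → resp {π} {ρ}) image-unique image-Q)

  -- The image of `f` together with one permutation outside it is still a list of distinct elements
  -- of `Q`.
  count-< : ∀ ρ → Q ρ → (∀ π → P π → ¬ ρ ≈ f π) → count P? < count Q?
  count-< ρ Qρ ρ∉image = subst (λ k → suc k ≤ count Q?) length-image
    (length≤count Q? (λ {π} {ρ} → resp {π} {ρ})
      (All.map⁺ (All.map (λ {π} → ρ∉image π) all-filter) ∷ image-unique)
      (Qρ ∷ image-Q))

module _ {P Q : Pred (Permutation′ n) 0ℓ} (P? : Decidable P) (Q? : Decidable Q) where

  count-cong : (∀ π → P π → Q π) → (∀ π → Q π → P π) → count P? ≡ count Q?
  count-cong f g = cong length
    (filter-≐ P? Q? ((λ {π} → f π) , (λ {π} → g π)) (permutations n))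

module _ {P : Pred (Permutation′ n) 0ℓ} (P? : Decidable P) where

  count-none : (∀ π → ¬ P π) → count P? ≡ 0
  count-none ¬P = cong length (filter-none P? (All.universal ¬P (permutations n)))

  count-≤1 : (∀ π ρ → P π → P ρ → π ≈ ρ) → count P? ≤ 1
  count-≤1 same = go (All.all-filter P? (permutations n))
                     (AllPairs.filter⁺ P? (permutations-unique n))
    where
    go : ∀ {xs} → All P xs → AllPairs (λ π ρ → ¬ π ≈ ρ) xs → length xs ≤ 1
    go []                []                  = z≤n
    go (_ ∷ [])          _                   = s≤s z≤n
    go (px ∷ py ∷ _) ((x≉y ∷ _) ∷ _) = contradiction (same _ _ px py) x≉y

  count-≥2 : P Respects _≈_ → ∀ π ρ → P π → P ρ → ¬ π ≈ ρ → 2 ≤ count P?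
  count-≥2 resp π ρ Pπ Pρ π≉ρ =
    length≤count P? (λ {π} {ρ} → resp {π} {ρ}) ((π≉ρ ∷ []) ∷ [] ∷ []) (Pπ ∷ Pρ ∷ [])

length-filter-map : ∀ {A B : Set} {P : Pred B 0ℓ} (P? : Decidable P) (f : A → B) xs →
                    length (filter P? (map f xs)) ≡ length (filter (P? ∘ f) xs)
length-filter-map P? f []       = refl
length-filter-map P? f (x ∷ xs) with does (P? (f x))
... | true  = cong suc (length-filter-map P? f xs)
... | false = length-filter-map P? f xs

-- `permutations (suc n)` is a concatenation of blocks, one for each first letter s, and the filter
-- acts on each block separately.
count-suc : {P : Pred (Permutation′ (suc n)) 0ℓ} (P? : Decidable P) →
            count P? ≡ sum (λ s → count (P? ∘ insert zero s))
count-suc {n} P? = go (λ s → s)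
  where
  -- `allFin` is `tabulate` of the identity; an arbitrary `g` in its place makes the induction on
  -- the number of blocks possible.
  go : ∀ {k} (g : Fin k → Fin (suc n)) →
       length (filter P? (cartesianProductWith (insert zero) (tabulate g) (permutations n)))
         ≡ sum (λ s → count (P? ∘ insert zero (g s)))
  go {zero}  g = refl
  go {suc k} g = begin
    length (filter P? (xs ++ ys))                     ≡⟨ cong length (filter-++ P? xs ys) ⟩
    length (filter P? xs ++ filter P? ys)             ≡⟨ length-++ (filter P? xs) ⟩
    length (filter P? xs) + length (filter P? ys)     ≡⟨ cong₂ _+_
      (length-filter-map P? (insert zero (g zero)) (permutations n)) (go (g ∘ suc)) ⟩
    _                                                 ∎
    where
    open ≡-Reasoning
    xs = map (insert zero (g zero)) (permutations n)
    ys = cartesianProductWith (insert zero) (tabulate (g ∘ suc)) (permutations n)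

-- Occurrences of patterns

⟨$⟩ʳ-injective : (π : Permutation′ n) {x y : Fin n} → π ⟨$⟩ʳ x ≡ π ⟨$⟩ʳ y → x ≡ y
⟨$⟩ʳ-injective π eq = trans (sym (inverseˡ π)) (trans (cong (π ⟨$⟩ˡ_) eq) (inverseˡ π))

opposite-mono-< : {x y : Fin n} → x Fin.< y → opposite y Fin.< opposite x
opposite-mono-< {x = x} {y} x<y = subst₂ _<_ (sym (Fin.opposite-prop y)) (sym (Fin.opposite-prop x))
  (ℕ.∸-monoʳ-< (s<s x<y) (Fin.toℕ<n y))

opposite-cancel-< : {x y : Fin n} → opposite x Fin.< opposite y → y Fin.< x
opposite-cancel-< {x = x} {y} ox<oy =
  subst₂ Fin._<_ (Fin.opposite-involutive y) (Fin.opposite-involutive x) (opposite-mono-< ox<oy)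

punchIn-mono-< : ∀ (i : Fin (suc n)) {x y} → x Fin.< y → punchIn i x Fin.< punchIn i y
punchIn-mono-< i {x} {y} x<y = ℕ.≰⇒> (ℕ.<⇒≱ x<y ∘ Fin.punchIn-cancel-≤ i y x)

punchIn-cancel-< : ∀ (i : Fin (suc n)) {x y} → punchIn i x Fin.< punchIn i y → x Fin.< y
punchIn-cancel-< i {x} {y} lt = ℕ.≰⇒> (ℕ.<⇒≱ lt ∘ Fin.punchIn-mono-≤ i y x)

<-punchIn⁺ : ∀ (i : Fin (suc n)) {x} → i Fin.≤ x → i Fin.< punchIn i x
<-punchIn⁺ zero              i≤x = z<s
<-punchIn⁺ (suc i) {suc x} i≤x = s<s (<-punchIn⁺ i (s≤s⁻¹ i≤x))

<-punchIn⁻ : ∀ (i : Fin (suc n)) {x} → i Fin.< punchIn i x → i Fin.≤ x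
<-punchIn⁻ zero            lt = z≤n
<-punchIn⁻ (suc i) {suc x} lt = s≤s (<-punchIn⁻ i (s<s⁻¹ lt))

toℕ-punchIn-fromℕ : ∀ n (x : Fin n) → toℕ (punchIn (fromℕ n) x) ≡ toℕ x
toℕ-punchIn-fromℕ (suc n) zero    = refl
toℕ-punchIn-fromℕ (suc n) (suc x) = cong suc (toℕ-punchIn-fromℕ n x)

fromℕ-maximum : (x : Fin (suc n)) → ¬ fromℕ n Fin.< x
fromℕ-maximum {n} x lt = ℕ.<⇒≱ (subst (_< toℕ x) (Fin.toℕ-fromℕ n) lt) (Fin.toℕ≤pred[n] x)

≢fromℕ⇒< : (x : Fin (suc n)) → x ≢ fromℕ n → x Fin.< fromℕ n
≢fromℕ⇒< {n} x x≢ = ℕ.≤∧≢⇒< (Fin.≤fromℕ x) (x≢ ∘ Fin.toℕ-injective)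

≢0⇒> : {x : Fin (suc n)} → x ≢ zero → Fin.zero {n} Fin.< x
≢0⇒> {x = zero}  x≢0 = contradiction refl x≢0
≢0⇒> {x = suc x} _   = z<s

module _ {σ : Permutation′ k} {τ : Permutation′ n} {ι : Fin k → Fin n} where

  -- One implication for positions a and b in either order, instead of an equivalence for a < b.
  -- This form does not refer to the order of the positions, so it survives symmetries that permute
  -- them.
  OrderPreserving : Set
  OrderPreserving = ∀ a b → (σ ⟨$⟩ʳ a) Fin.< (σ ⟨$⟩ʳ b) → (τ ⟨$⟩ʳ ι a) Fin.< (τ ⟨$⟩ʳ ι b)

  occurrence⇒orderPreserving : IsOccurrence σ τ ι → OrderPreserving
  occurrence⇒orderPreserving (mono , iso) a b σa<σb with Fin.<-cmp a b
  ... | tri< a<b _ _ = from (iso a b a<b) σa<σb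
  ... | tri≈ _ refl _ = contradiction σa<σb (ℕ.<-irrefl refl)
  ... | tri> _ _ b<a with Fin.<-cmp (τ ⟨$⟩ʳ ι a) (τ ⟨$⟩ʳ ι b)
  ...   | tri< lt _ _ = lt
  ...   | tri≈ _ eq _ = contradiction (cong toℕ (⟨$⟩ʳ-injective τ (sym eq))) (ℕ.<⇒≢ (mono b<a))
  ...   | tri> _ _ gt = contradiction (to (iso b a b<a) gt) (ℕ.<-asym σa<σb)

  orderPreserving⇒occurrence : ι Preserves Fin._<_ ⟶ Fin._<_ → OrderPreserving →
                               IsOccurrence σ τ ι
  orderPreserving⇒occurrence mono pres = mono , λ a b a<b → mk⇔ (reflects a b) (pres a b)
    where
    reflects : ∀ a b → (τ ⟨$⟩ʳ ι a) Fin.< (τ ⟨$⟩ʳ ι b) → (σ ⟨$⟩ʳ a) Fin.< (σ ⟨$⟩ʳ b)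
    reflects a b lt with Fin.<-cmp (σ ⟨$⟩ʳ a) (σ ⟨$⟩ʳ b)
    ... | tri< σa<σb _ _ = σa<σb
    ... | tri≈ _ eq _ = contradiction lt
            (ℕ.<-irrefl (cong (λ c → toℕ (τ ⟨$⟩ʳ ι c)) (⟨$⟩ʳ-injective σ eq)))
    ... | tri> _ _ gt = contradiction lt (ℕ.<-asym (pres b a gt))

contains-resp-≈ : {τ τ′ : Permutation′ n} {σ σ′ : Permutation′ k} → τ ≈ τ′ → σ ≈ σ′ →
                  Contains τ σ → Contains τ′ σ′
contains-resp-≈ τ≈τ′ σ≈σ′ (ι , mono , iso) = ι , mono , λ a b a<b →
  subst₂ _⇔_ (cong₂ Fin._<_ (τ≈τ′ (ι a)) (τ≈τ′ (ι b))) (cong₂ Fin._<_ (σ≈σ′ a) (σ≈σ′ b))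
         (iso a b a<b)

avoids-resp-≈ : {τ τ′ : Permutation′ n} {σ σ′ : Permutation′ k} → τ ≈ τ′ → σ ≈ σ′ →
                Avoids τ σ → Avoids τ′ σ′
avoids-resp-≈ {τ = τ} {τ′} {σ} {σ′} τ≈τ′ σ≈σ′ avoids =
  avoids ∘ contains-resp-≈ {τ = τ′} {τ} {σ′} {σ} (sym ∘ τ≈τ′) (sym ∘ σ≈σ′)

module _ (τ : Permutation′ n) (σ : Permutation′ k) where

  contains-complement : Contains τ σ → Contains (τ ∘ₚ reverse) (σ ∘ₚ reverse)
  contains-complement (ι , occ@(mono , _)) =
    ι , orderPreserving⇒occurrence {σ = σ ∘ₚ reverse} {τ ∘ₚ reverse} mono
      (λ a b lt → opposite-mono-<
        (occurrence⇒orderPreserving {σ = σ} {τ} occ b a (opposite-cancel-< lt)))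

  contains-reverse : Contains τ σ → Contains (reverse ∘ₚ τ) (reverse ∘ₚ σ)
  contains-reverse (ι , occ@(mono , _)) =
    opposite ∘ ι ∘ opposite ,
    orderPreserving⇒occurrence {σ = reverse ∘ₚ σ} {reverse ∘ₚ τ}
      (λ a<b → opposite-mono-< (mono (opposite-mono-< a<b)))
      (λ a b lt → subst₂ (λ x y → (τ ⟨$⟩ʳ x) Fin.< (τ ⟨$⟩ʳ y))
        (sym (Fin.opposite-involutive _)) (sym (Fin.opposite-involutive _))
        (occurrence⇒orderPreserving {σ = σ} {τ} occ (opposite a) (opposite b) lt))

  -- In the inverse, positions and values trade roles: the new positions are the old values, listed
  -- in increasing order by means of the inverse of σ. Monotonicity of the new embedding is order
  -- preservation of the old one, and conversely.
  contains-flip : Contains τ σ → Contains (flip τ) (flip σ)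
  contains-flip (ι , occ@(mono , _)) =
    (λ a → τ ⟨$⟩ʳ ι (σ ⟨$⟩ˡ a)) ,
    orderPreserving⇒occurrence {σ = flip σ} {flip τ}
      (λ {a} {b} a<b → occurrence⇒orderPreserving {σ = σ} {τ} occ _ _
        (subst₂ Fin._<_ (sym (inverseʳ σ)) (sym (inverseʳ σ)) a<b))
      (λ a b lt → subst₂ Fin._<_ (sym (inverseˡ τ)) (sym (inverseˡ τ)) (mono lt))

TripleOccurrence : Permutation′ 3 → Permutation′ n → Set
TripleOccurrence σ τ = ∃[ a ] ∃[ b ] ∃[ c ] a Fin.< b × b Fin.< c ×
  ((τ ⟨$⟩ʳ a) Fin.< (τ ⟨$⟩ʳ b) ⇔ (σ ⟨$⟩ʳ 0F) Fin.< (σ ⟨$⟩ʳ 1F)) ×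
  ((τ ⟨$⟩ʳ a) Fin.< (τ ⟨$⟩ʳ c) ⇔ (σ ⟨$⟩ʳ 0F) Fin.< (σ ⟨$⟩ʳ 2F)) ×
  ((τ ⟨$⟩ʳ b) Fin.< (τ ⟨$⟩ʳ c) ⇔ (σ ⟨$⟩ʳ 1F) Fin.< (σ ⟨$⟩ʳ 2F))

contains⇒triple : (τ : Permutation′ n) (σ : Permutation′ 3) →
                  Contains τ σ → TripleOccurrence σ τ
contains⇒triple τ σ (ι , mono , iso) =
  ι 0F , ι 1F , ι 2F , mono z<s , mono (s<s z<s) ,
  iso 0F 1F z<s , iso 0F 2F z<s , iso 1F 2F (s<s z<s)

triple⇒contains : (τ : Permutation′ n) (σ : Permutation′ 3) →
                  TripleOccurrence σ τ → Contains τ σ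
triple⇒contains {n} τ σ (a , b , c , a<b , b<c , ab , ac , bc) = ι , mono , iso
  where
  ι : Fin 3 → Fin n
  ι 0F = a
  ι 1F = b
  ι 2F = c
  mono : ι Preserves Fin._<_ ⟶ Fin._<_
  mono {0F} {1F} _ = a<b
  mono {0F} {2F} _ = ℕ.<-trans a<b b<c
  mono {1F} {2F} _ = b<c
  mono {1F} {1F} (s≤s ())
  mono {2F} {1F} (s≤s ())
  mono {2F} {2F} (s≤s (s≤s ()))
  iso : ∀ x y → x Fin.< y →
        (τ ⟨$⟩ʳ ι x) Fin.< (τ ⟨$⟩ʳ ι y) ⇔ (σ ⟨$⟩ʳ x) Fin.< (σ ⟨$⟩ʳ y)
  iso 0F 1F _ = ab
  iso 0F 2F _ = ac
  iso 1F 2F _ = bc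
  iso 1F 1F (s≤s ())
  iso 2F 1F (s≤s ())
  iso 2F 2F (s≤s (s≤s ()))

-- The occurrences of σ in insert zero i π that use the first letter i: the letter of
-- insert zero i π coming from the letter x of π exceeds i exactly when i ≤ x.
Starts : Permutation′ 3 → Fin (suc n) → Permutation′ n → Set
Starts σ i π = ∃[ b ] ∃[ c ] b Fin.< c ×
  (i Fin.≤ (π ⟨$⟩ʳ b) ⇔ (σ ⟨$⟩ʳ 0F) Fin.< (σ ⟨$⟩ʳ 1F)) ×
  (i Fin.≤ (π ⟨$⟩ʳ c) ⇔ (σ ⟨$⟩ʳ 0F) Fin.< (σ ⟨$⟩ʳ 2F)) ×
  ((π ⟨$⟩ʳ b) Fin.< (π ⟨$⟩ʳ c) ⇔ (σ ⟨$⟩ʳ 1F) Fin.< (σ ⟨$⟩ʳ 2F))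

module _ (σ : Permutation′ 3) (i : Fin (suc n)) (π : Permutation′ n) where

  private
    τ : Permutation′ (suc n)
    τ = insert zero i π

  contains-insert⁻ : Contains τ σ → Contains π σ ⊎ Starts σ i π
  contains-insert⁻ occ with contains⇒triple τ σ occ
  ... | zero , suc b , suc c , _ , b<c , ab , ac , bc =
    inj₂ (b , c , s<s⁻¹ b<c ,
      mk⇔ (to ab ∘ <-punchIn⁺ i) (<-punchIn⁻ i ∘ from ab) ,
      mk⇔ (to ac ∘ <-punchIn⁺ i) (<-punchIn⁻ i ∘ from ac) ,
      mk⇔ (to bc ∘ punchIn-mono-< i) (punchIn-cancel-< i ∘ from bc))
  ... | suc a , suc b , suc c , a<b , b<c , ab , ac , bc =
    inj₁ (triple⇒contains π σ (a , b , c , s<s⁻¹ a<b , s<s⁻¹ b<c , tail ab , tail ac , tail bc))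
    where
    tail : ∀ {x y} {C : Set} → punchIn i x Fin.< punchIn i y ⇔ C → x Fin.< y ⇔ C
    tail e = mk⇔ (to e ∘ punchIn-mono-< i) (punchIn-cancel-< i ∘ from e)

  contains-insert⁺ : Contains π σ → Contains τ σ
  contains-insert⁺ (ι , mono , iso) = suc ∘ ι , s<s ∘ mono , λ a b a<b →
    mk⇔ (to (iso a b a<b) ∘ punchIn-cancel-< i) (punchIn-mono-< i ∘ from (iso a b a<b))

  starts⇒contains-insert : Starts σ i π → Contains τ σ
  starts⇒contains-insert (b , c , b<c , ib , ic , bc) =
    triple⇒contains τ σ (zero , suc b , suc c , z<s , s<s b<c ,
      mk⇔ (to ib ∘ <-punchIn⁻ i) (<-punchIn⁺ i ∘ from ib) ,
      mk⇔ (to ic ∘ <-punchIn⁻ i) (<-punchIn⁺ i ∘ from ic) ,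
      mk⇔ (to bc ∘ punchIn-cancel-< i) (punchIn-mono-< i ∘ from bc))

  avoids-insert : Avoids π σ → ¬ Starts σ i π → Avoids τ σ
  avoids-insert avoids ¬starts = [ avoids , ¬starts ]′ ∘ contains-insert⁻

-- The six patterns of length three.

perm3 : Fin 3 → Fin 2 → Permutation′ 3
perm3 i j = insert zero i (insert zero j (insert zero zero id))

s123 s132 s213 s231 s312 s321 : Permutation′ 3
s123 = perm3 0F 0F
s132 = perm3 0F 1F
s213 = perm3 1F 0F
s231 = perm3 1F 1F
s312 = perm3 2F 0F
s321 = perm3 2F 1F

both : {A B : Set} → A → B → A ⇔ B
both a b = mk⇔ (λ _ → b) (λ _ → a)

neither : {A B : Set} → ¬ A → ¬ B → A ⇔ B
neither ¬a ¬b = mk⇔ (λ a → contradiction a ¬a) (λ b → contradiction b ¬b)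

module _ (π : Permutation′ n) {a b c : Fin n} (a<b : a Fin.< b) (b<c : b Fin.< c) where

  contains-123 : (π ⟨$⟩ʳ a) Fin.< (π ⟨$⟩ʳ b) → (π ⟨$⟩ʳ b) Fin.< (π ⟨$⟩ʳ c) → Contains π s123
  contains-123 ab bc = triple⇒contains π s123
    (a , b , c , a<b , b<c , both ab z<s , both (ℕ.<-trans ab bc) z<s , both bc (s<s z<s))

  contains-132 : (π ⟨$⟩ʳ a) Fin.< (π ⟨$⟩ʳ c) → (π ⟨$⟩ʳ c) Fin.< (π ⟨$⟩ʳ b) → Contains π s132
  contains-132 ac cb = triple⇒contains π s132
    (a , b , c , a<b , b<c , both (ℕ.<-trans ac cb) z<s , both ac z<s ,
     neither (ℕ.<-asym cb) λ { (s≤s ()) })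

-- For each of these patterns the three comparisons form a chain of two inequalities, which implies
-- the third.
module _ {i : Fin (suc n)} (π : Permutation′ n) {b c : Fin n} (b<c : b Fin.< c) where

  starts-123⁺ : i Fin.≤ (π ⟨$⟩ʳ b) → (π ⟨$⟩ʳ b) Fin.< (π ⟨$⟩ʳ c) → Starts s123 i π
  starts-123⁺ ib bc =
    b , c , b<c , both ib z<s , both (ℕ.≤-trans ib (ℕ.<⇒≤ bc)) z<s , both bc (s<s z<s)

  starts-132⁺ : i Fin.≤ (π ⟨$⟩ʳ c) → (π ⟨$⟩ʳ c) Fin.< (π ⟨$⟩ʳ b) → Starts s132 i π
  starts-132⁺ ic cb =
    b , c , b<c , both (ℕ.≤-trans ic (ℕ.<⇒≤ cb)) z<s , both ic z<s ,
    neither (ℕ.<-asym cb) λ { (s≤s ()) }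

  starts-213⁺ : (π ⟨$⟩ʳ b) Fin.< i → i Fin.≤ (π ⟨$⟩ʳ c) → Starts s213 i π
  starts-213⁺ bi ic =
    b , c , b<c , neither (ℕ.<⇒≱ bi) (λ ()) , both ic (s<s z<s) , both (ℕ.<-≤-trans bi ic) z<s

  starts-231⁺ : i Fin.≤ (π ⟨$⟩ʳ b) → (π ⟨$⟩ʳ c) Fin.< i → Starts s231 i π
  starts-231⁺ ib ci =
    b , c , b<c , both ib (s<s z<s) , neither (ℕ.<⇒≱ ci) (λ ()) ,
    neither (ℕ.<⇒≯ (ℕ.<-≤-trans ci ib)) (λ ())

  starts-321⁺ : (π ⟨$⟩ʳ b) Fin.< i → (π ⟨$⟩ʳ c) Fin.< (π ⟨$⟩ʳ b) → Starts s321 i π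
  starts-321⁺ bi cb =
    b , c , b<c , neither (ℕ.<⇒≱ bi) (λ { (s≤s ()) }) ,
    neither (ℕ.<⇒≱ (ℕ.<-trans cb bi)) (λ ()) , neither (ℕ.<-asym cb) (λ ())

module _ {i : Fin (suc n)} (π : Permutation′ n) where

  starts-123⁻ : Starts s123 i π →
    ∃[ b ] ∃[ c ] b Fin.< c × i Fin.≤ (π ⟨$⟩ʳ b) × (π ⟨$⟩ʳ b) Fin.< (π ⟨$⟩ʳ c)
  starts-123⁻ (b , c , b<c , ib , _ , bc) = b , c , b<c , from ib z<s , from bc (s<s z<s)

  starts-132⁻ : Starts s132 i π →
    ∃[ b ] ∃[ c ] b Fin.< c × i Fin.≤ (π ⟨$⟩ʳ c) × (π ⟨$⟩ʳ c) Fin.< (π ⟨$⟩ʳ b)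
  starts-132⁻ (b , c , b<c , ib , ic , bc) = b , c , b<c , from ic z<s ,
    -- The pattern only refutes π(b) < π(c); the strict reverse inequality uses that π is injective
    -- and b ≠ c.
    ℕ.≤∧≢⇒< (ℕ.≮⇒≥ λ b<c′ → contradiction (to bc b<c′) λ { (s≤s ()) })
            (λ eq → ℕ.<⇒≢ b<c (cong toℕ (sym (⟨$⟩ʳ-injective π (Fin.toℕ-injective eq)))))

  starts-213⁻ : Starts s213 i π →
    ∃[ b ] ∃[ c ] b Fin.< c × (π ⟨$⟩ʳ b) Fin.< i × i Fin.≤ (π ⟨$⟩ʳ c)
  starts-213⁻ (b , c , b<c , ib , ic , bc) =
    b , c , b<c , ℕ.≰⇒> (λ i≤b → contradiction (to ib i≤b) λ ()) , from ic (s<s z<s)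

  starts-231⁻ : Starts s231 i π →
    ∃[ b ] ∃[ c ] b Fin.< c × i Fin.≤ (π ⟨$⟩ʳ b) × (π ⟨$⟩ʳ c) Fin.< i
  starts-231⁻ (b , c , b<c , ib , ic , bc) =
    b , c , b<c , from ib (s<s z<s) , ℕ.≰⇒> (λ i≤c → contradiction (to ic i≤c) λ ())

-- Refinement by the first letter

avoids-insert? : (i : Fin (suc n)) (σ : Permutation′ k) (π : Permutation′ n) →
                 Dec (Avoids (insert zero i π) σ)
avoids-insert? i σ π = ¬? (contains? (insert zero i π) σ)

opaque
  -- |S_{n+1,i+1}(σ)|
  cardFrom : Fin (suc n) → Permutation′ k → ℕ
  cardFrom i σ = count (avoids-insert? i σ)

  -- Here s is the first letter of the standardised rest, so counted from 0 the second letter of the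
  -- word is s if s < i and s + 1 if s ≥ i.
  cardFrom₂ : Fin (suc (suc n)) → Fin (suc n) → Permutation′ k → ℕ
  cardFrom₂ i s σ = count (λ ρ → avoids-insert? i σ (insert zero s ρ))

module _ (i : Fin (suc (suc n))) (π : Permutation′ (suc n)) where
  private
    s = π ⟨$⟩ʳ zero

    π⁻¹[_]>0 : ∀ v → s ≢ v → Fin.zero {n} Fin.< (π ⟨$⟩ˡ v)
    π⁻¹[ v ]>0 s≢v = ≢0⇒> λ eq → s≢v (trans (cong (π ⟨$⟩ʳ_) (sym eq)) (inverseʳ π))

  -- If i < s, the value i occurs in π after its first letter s. In the whole word the letters i, s
  -- + 1, i + 1 then form a 132.
  ¬starts-132⇒head≤ : ¬ Starts s132 i π → s Fin.≤ i
  ¬starts-132⇒head≤ ¬starts = ℕ.≮⇒≥ λ i<s →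
    let i<1+n = ℕ.<-trans i<s (Fin.toℕ<n s)
        v     = fromℕ< i<1+n
        π[π⁻¹v]≡i = trans (cong toℕ (inverseʳ π {v})) (Fin.toℕ-fromℕ< i<1+n)
    in ¬starts (starts-132⁺ π
         (π⁻¹[ v ]>0 λ s≡v → ℕ.<⇒≢ i<s (sym (trans (cong toℕ s≡v) (Fin.toℕ-fromℕ< i<1+n))))
         (ℕ.≤-reflexive (sym π[π⁻¹v]≡i))
         (subst (_< toℕ s) (sym π[π⁻¹v]≡i) i<s))

  -- In an occurrence that uses the first letter i, the letter s can replace i: from s ≤ i it lies
  -- weakly below both other letters. It differs from them because the lower one, π(c), is not at
  -- position 0, and neither is the higher one, π(b) > s. So π itself would contain 132.
  head≤⇒¬starts-132 : Avoids π s132 → s Fin.≤ i → ¬ Starts s132 i π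
  head≤⇒¬starts-132 avoids s≤i starts with starts-132⁻ π starts
  ... | b , c , b<c , i≤πc , πc<πb = avoids (contains-132 π (0<b b (ℕ.≤-<-trans s≤πc πc<πb)) b<c
          (ℕ.≤∧≢⇒< s≤πc λ eq → ℕ.<⇒≢ (ℕ.≤-<-trans z≤n b<c)
            (cong toℕ (⟨$⟩ʳ-injective π (Fin.toℕ-injective eq)))) πc<πb)
    where
    s≤πc : s Fin.≤ (π ⟨$⟩ʳ c)
    s≤πc = ℕ.≤-trans s≤i i≤πc
    0<b : ∀ b → s Fin.< (π ⟨$⟩ʳ b) → Fin.zero {n} Fin.< b
    0<b zero    s<s′ = contradiction s<s′ (ℕ.<-irrefl refl)
    0<b (suc b) _    = z<s

  -- As s < i, an ascent of π with both letters at least i does not involve s, and s in front of it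
  -- gives a 123 inside π.
  head<⇒¬starts-123 : Avoids π s123 → s Fin.< i → ¬ Starts s123 i π
  head<⇒¬starts-123 avoids s<i starts with starts-123⁻ π starts
  ... | zero  , c , _   , i≤s , _ = ℕ.<⇒≱ s<i i≤s
  ... | suc b , c , b<c , i≤πb , πb<πc =
    avoids (contains-123 π z<s b<c (ℕ.<-≤-trans s<i i≤πb) πb<πc)

  -- Otherwise the maximum occurs in π after s, and the first letter, s and the maximum form a 123.
  ¬starts-123⇒head≡max : i Fin.≤ s → ¬ Starts s123 i π → s ≡ fromℕ n
  ¬starts-123⇒head≡max i≤s ¬starts with s Fin.≟ fromℕ n
  ... | yes s≡max = s≡max
  ... | no  s≢max = contradiction
    (starts-123⁺ π (π⁻¹[ fromℕ n ]>0 s≢max) i≤s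
      (subst (s Fin.<_) (sym (inverseʳ π)) (≢fromℕ⇒< s s≢max)))
    ¬starts

module _ (ρ : Permutation′ n) where
  private
    π : Permutation′ (suc n)
    π = insert zero (fromℕ n) ρ

    toℕ-π : ∀ x → toℕ (π ⟨$⟩ʳ suc x) ≡ toℕ (ρ ⟨$⟩ʳ x)
    toℕ-π x = toℕ-punchIn-fromℕ n (ρ ⟨$⟩ʳ x)

  max≰ : ∀ x → ¬ fromℕ n Fin.≤ (ρ ⟨$⟩ʳ x)
  max≰ x = ℕ.<⇒≱ (subst (toℕ (ρ ⟨$⟩ʳ x) <_) (sym (Fin.toℕ-fromℕ n)) (Fin.toℕ<n (ρ ⟨$⟩ʳ x)))

  module _ (i : Fin (suc n)) where

    private
      toℕ-i : toℕ (inject₁ i) ≡ toℕ i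
      toℕ-i = Fin.toℕ-inject₁ i

    -- The maximum in front of ρ cannot be the lower letter of an ascent, and standing first it
    -- cannot be the upper one either. Hence inserting or deleting it does not affect the ascents
    -- above i. `inject₁` keeps the value of i while the alphabet grows by one letter.
    starts-123-max⁺ : Starts s123 i ρ → Starts s123 (inject₁ i) π
    starts-123-max⁺ starts with starts-123⁻ ρ starts
    ... | b , c , b<c , i≤b , b<c′ = starts-123⁺ π {suc b} {suc c} (s<s b<c)
      (subst₂ _≤_ (sym toℕ-i) (sym (toℕ-π b)) i≤b)
      (subst₂ _<_ (sym (toℕ-π b)) (sym (toℕ-π c)) b<c′)

    starts-123-max⁻ : Starts s123 (inject₁ i) π → Starts s123 i ρ
    starts-123-max⁻ starts with starts-123⁻ π starts
    ... | zero  , c     , _   , _   , b<c′ = contradiction b<c′ (fromℕ-maximum (π ⟨$⟩ʳ c))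
    ... | suc b , suc c , b<c , i≤b , b<c′ = starts-123⁺ ρ (s<s⁻¹ b<c)
      (subst₂ _≤_ toℕ-i (toℕ-π b) i≤b) (subst₂ _<_ (toℕ-π b) (toℕ-π c) b<c′)

    avoids-123-max⁻ : Avoids (insert zero (inject₁ i) π) s123 → Avoids (insert zero i ρ) s123
    avoids-123-max⁻ avoids = avoids-insert s123 i ρ
      (avoids ∘ contains-insert⁺ s123 _ π ∘ contains-insert⁺ s123 _ ρ)
      (avoids ∘ starts⇒contains-insert s123 _ π ∘ starts-123-max⁺)

    avoids-123-max⁺ : Avoids (insert zero i ρ) s123 → Avoids (insert zero (inject₁ i) π) s123
    avoids-123-max⁺ avoids = avoids-insert s123 _ π
      -- The maximum followed by ρ avoids 123: ρ does, and no letter of ρ exceeds the maximum.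
      (avoids-insert s123 _ ρ (avoids ∘ contains-insert⁺ s123 i ρ)
        λ starts → let b , _ , _ , max≤ , _ = starts-123⁻ ρ starts in max≰ b max≤)
      (avoids ∘ starts⇒contains-insert s123 i ρ ∘ starts-123-max⁻)

opaque
  unfolding cardFrom cardFrom₂

  cardFrom-suc : (i : Fin (suc (suc n))) (σ : Permutation′ k) →
                 cardFrom i σ ≡ sum (λ s → cardFrom₂ i s σ)
  cardFrom-suc i σ = count-suc (avoids-insert? i σ)

  cardFrom-132≡123-base : cardFrom {0} zero s132 ≡ cardFrom {0} zero s123
  -- Both counts evaluate to 1, the only word being too short for either pattern.
  cardFrom-132≡123-base = trans {j = 1} refl refl

module _ (i : Fin (suc (suc n))) (s : Fin (suc n)) where
  opaque
    unfolding cardFrom cardFrom₂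

    cardFrom₂-132-≤ : s Fin.≤ i → cardFrom₂ i s s132 ≡ cardFrom s s132
    cardFrom₂-132-≤ s≤i = count-cong
      (λ ρ → avoids-insert? i s132 (insert zero s ρ)) (avoids-insert? s s132)
      (λ ρ avoids → avoids ∘ contains-insert⁺ s132 i (insert zero s ρ))
      (λ ρ avoids → avoids-insert s132 i (insert zero s ρ) avoids
        (head≤⇒¬starts-132 i (insert zero s ρ) avoids s≤i))

    cardFrom₂-132-> : i Fin.< s → cardFrom₂ i s s132 ≡ 0
    cardFrom₂-132-> i<s = count-none (λ ρ → avoids-insert? i s132 (insert zero s ρ)) λ ρ avoids →
      ℕ.<⇒≱ i<s (¬starts-132⇒head≤ i (insert zero s ρ)
                  (avoids ∘ starts⇒contains-insert s132 i (insert zero s ρ)))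

    cardFrom₂-123-< : s Fin.< i → cardFrom₂ i s s123 ≡ cardFrom s s123
    cardFrom₂-123-< s<i = count-cong
      (λ ρ → avoids-insert? i s123 (insert zero s ρ)) (avoids-insert? s s123)
      (λ ρ avoids → avoids ∘ contains-insert⁺ s123 i (insert zero s ρ))
      (λ ρ avoids → avoids-insert s123 i (insert zero s ρ) avoids
        (head<⇒¬starts-123 i (insert zero s ρ) avoids s<i))

    cardFrom₂-123-≥ : i Fin.≤ s → s ≢ fromℕ n → cardFrom₂ i s s123 ≡ 0
    cardFrom₂-123-≥ i≤s s≢max = count-none (λ ρ → avoids-insert? i s123 (insert zero s ρ))
      λ ρ avoids →
      s≢max (¬starts-123⇒head≡max i (insert zero s ρ) i≤s
              (avoids ∘ starts⇒contains-insert s123 i (insert zero s ρ)))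

opaque
  unfolding cardFrom cardFrom₂

  cardFrom₂-123-max : (i : Fin (suc n)) → cardFrom₂ (inject₁ i) (fromℕ n) s123 ≡ cardFrom i s123
  cardFrom₂-123-max {n} i = count-cong
    (λ ρ → avoids-insert? (inject₁ i) s123 (insert zero (fromℕ n) ρ)) (avoids-insert? i s123)
    (λ ρ → avoids-123-max⁻ ρ i) (λ ρ → avoids-123-max⁺ ρ i)

transpose-fixes : {i j k : Fin n} → k ≢ i → k ≢ j → Components.transpose i j k ≡ k
transpose-fixes {i = i} {j} {k} k≢i k≢j
  rewrite dec-false (k Fin.≟ i) k≢i | dec-false (k Fin.≟ j) k≢j = refl

transpose-left : (i j : Fin n) → Components.transpose i j i ≡ j
transpose-left i j rewrite dec-true (i Fin.≟ i) refl = refl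

transpose-right : (i j : Fin n) → j ≢ i → Components.transpose i j j ≡ i
transpose-right i j j≢i rewrite dec-false (j Fin.≟ i) j≢i | dec-true (j Fin.≟ j) refl = refl

sum-transpose : {f g : Fin n → ℕ} (i j : Fin n) →
                (∀ s → f s ≡ g (Components.transpose i j s)) → sum f ≡ sum g
sum-transpose {g = g} i j f≗g∘transpose =
  trans (sum-cong-≗ f≗g∘transpose) (sym (sum-permute g (transpose i j)))

-- For both patterns the second letter s is unrestricted below the first letter i.  Of the
-- others only s = i (for 132) and the maximum (for 123) are possible; they are exchanged
-- by a transposition.
cardFrom-132≡123 : ∀ n (i : Fin (suc n)) → cardFrom i s132 ≡ cardFrom i s123
cardFrom-132≡123 zero    zero = cardFrom-132≡123-base
cardFrom-132≡123 (suc n) i = begin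
  cardFrom i s132                  ≡⟨ cardFrom-suc i s132 ⟩
  sum (λ s → cardFrom₂ i s s132)   ≡⟨ sums i (view i) ⟩
  sum (λ s → cardFrom₂ i s s123)   ≡⟨ cardFrom-suc i s123 ⟨
  cardFrom i s123                  ∎
  where
  open ≡-Reasoning

  below : ∀ i s → s Fin.< i → cardFrom₂ i s s132 ≡ cardFrom₂ i s s123
  below i s s<i = begin
    cardFrom₂ i s s132  ≡⟨ cardFrom₂-132-≤ i s (ℕ.<⇒≤ s<i) ⟩
    cardFrom s s132     ≡⟨ cardFrom-132≡123 n s ⟩
    cardFrom s s123     ≡⟨ cardFrom₂-123-< i s s<i ⟨
    cardFrom₂ i s s123  ∎

  module _ (i : Fin (suc n)) where
    toℕ-i : toℕ (inject₁ i) ≡ toℕ i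
    toℕ-i = Fin.toℕ-inject₁ i

    f g : Fin (suc n) → ℕ
    f s = cardFrom₂ (inject₁ i) s s132
    g s = cardFrom₂ (inject₁ i) s s123

    swapped : Fin (suc n) → Fin (suc n)
    swapped = Components.transpose i (fromℕ n)

    f≗g∘swapped : ∀ s → Tri (s Fin.< i) (s ≡ i) (i Fin.< s) → f s ≡ g (swapped s)
    f≗g∘swapped s (tri< s<i s≢i _) = begin
      f s            ≡⟨ below (inject₁ i) s (subst (toℕ s <_) (sym toℕ-i) s<i) ⟩
      g s            ≡⟨ cong g (transpose-fixes s≢i s≢max) ⟨
      g (swapped s)  ∎
      where
      s≢max : s ≢ fromℕ n
      s≢max refl = fromℕ-maximum i s<i
    f≗g∘swapped s (tri≈ _ refl _) = begin
      f s              ≡⟨ cardFrom₂-132-≤ (inject₁ i) s (ℕ.≤-reflexive (sym toℕ-i)) ⟩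
      cardFrom s s132  ≡⟨ cardFrom-132≡123 n s ⟩
      cardFrom s s123  ≡⟨ cardFrom₂-123-max s ⟨
      g (fromℕ n)      ≡⟨ cong g (transpose-left s (fromℕ n)) ⟨
      g (swapped s)    ∎
    f≗g∘swapped s (tri> _ s≢i i<s) = begin
      f s              ≡⟨ cardFrom₂-132-> (inject₁ i) s (subst (_< toℕ s) (sym toℕ-i) i<s) ⟩
      0                ≡⟨ g-vanishes (s Fin.≟ fromℕ n) ⟨
      g (swapped s)    ∎
      where
      g-vanishes : Dec (s ≡ fromℕ n) → g (swapped s) ≡ 0
      -- The transposition takes the maximum back to i, and i is a forbidden second letter for 123
      -- because here it is not the maximum.
      g-vanishes (yes refl) = begin
        g (swapped s)  ≡⟨ cong g (transpose-right i (fromℕ n) s≢i) ⟩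
        g i            ≡⟨ cardFrom₂-123-≥ (inject₁ i) i (ℕ.≤-reflexive toℕ-i) (s≢i ∘ sym) ⟩
        0              ∎
      g-vanishes (no s≢max) = begin
        g (swapped s)  ≡⟨ cong g (transpose-fixes s≢i s≢max) ⟩
        g s            ≡⟨ cardFrom₂-123-≥ (inject₁ i) s
                            (subst (_≤ toℕ s) (sym toℕ-i) (ℕ.<⇒≤ i<s)) s≢max ⟩
        0              ∎

  sums : ∀ i → View i → sum (λ s → cardFrom₂ i s s132) ≡ sum (λ s → cardFrom₂ i s s123)
  -- If i is the largest letter, every s lies below it and the sums agree term by term.
  sums i ‵fromℕ = sum-cong-≗ {x = λ s → cardFrom₂ i s s132} {y = λ s → cardFrom₂ i s s123}
    λ s → below i s (subst (toℕ s <_) (sym (Fin.toℕ-fromℕ (suc n))) (Fin.toℕ<n s))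
  sums _ (‵inject₁ i) = sum-transpose {f = f i} {g = g i} i (fromℕ n)
    λ s → f≗g∘swapped i s (Fin.<-cmp s i)

-- Symmetries

module _ {i : Fin (suc n)} {σ : Permutation′ k} (τ : Permutation′ (suc n)) where

  inS-head : InS (suc n) (suc (toℕ i)) σ τ → τ ⟨$⟩ʳ zero ≡ i
  inS-head (head≡ , _) = Fin.toℕ-injective (ℕ.suc-injective (just-injective head≡))

  inS⁺ : τ ⟨$⟩ʳ zero ≡ i → Avoids τ σ → InS (suc n) (suc (toℕ i)) σ τ
  inS⁺ τ0≡i avoids = cong (just ∘ suc ∘ toℕ) τ0≡i , avoids

  inS-resp-≈ : {τ′ : Permutation′ (suc n)} {σ′ : Permutation′ k} → τ ≈ τ′ → σ ≈ σ′ →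
               InS (suc n) (suc (toℕ i)) σ τ → InS (suc n) (suc (toℕ i)) σ′ τ′
  inS-resp-≈ {τ′} {σ′} τ≈τ′ σ≈σ′ (head≡ , avoids) =
    trans (cong (just ∘ suc ∘ toℕ) (sym (τ≈τ′ zero))) head≡ ,
    avoids-resp-≈ {τ = τ} {τ′} {σ} {σ′} τ≈τ′ σ≈σ′ avoids

insert-remove-head : {i : Fin (suc n)} (τ : Permutation′ (suc n)) → τ ⟨$⟩ʳ zero ≡ i →
                     insert zero i (remove zero τ) ≈ τ
insert-remove-head τ refl = insert-remove zero τ

avoids-insert-resp-≈ : (i : Fin (suc n)) (σ : Permutation′ k) {π ρ : Permutation′ n} → π ≈ ρ →
                       Avoids (insert zero i π) σ → Avoids (insert zero i ρ) σ
avoids-insert-resp-≈ i σ {π} {ρ} π≈ρ = avoids-resp-≈ {τ = insert zero i π} {insert zero i ρ} {σ} {σ}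
  (insert-cong {i = i} {π = π} {ρ} refl π≈ρ) (λ _ → refl)

opaque
  unfolding cardFrom

  -- Deleting the first letter is injective on words that start with i, since inserting i again
  -- recovers the word; insertion gives the other inequality.
  cardS≡cardFrom : (i : Fin (suc n)) (σ : Permutation′ k) →
                   cardS (suc n) (suc (toℕ i)) σ ≡ cardFrom i σ
  cardS≡cardFrom {n} i σ = ℕ.≤-antisym
    (count-≤ (inS? (suc n) (suc (toℕ i)) σ) (avoids-insert? i σ)
      (λ {π} {ρ} → avoids-insert-resp-≈ i σ {π} {ρ}) (remove zero)
      (λ τ (τ∈S@(_ , avoids)) → avoids-resp-≈ {τ = τ} {insert zero i (remove zero τ)} {σ} {σ}
        (sym ∘ insert-remove-head τ (inS-head {i = i} {σ} τ τ∈S)) (λ _ → refl) avoids)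
      (λ τ τ′ τ∈S τ′∈S eq x → trans
        (sym (insert-remove-head τ (inS-head {i = i} {σ} τ τ∈S) x)) (trans
        (insert-cong {i = i} {π = remove zero τ} {remove zero τ′} refl eq x)
        (insert-remove-head τ′ (inS-head {i = i} {σ} τ′ τ′∈S) x))))
    (count-≤ (avoids-insert? i σ) (inS? (suc n) (suc (toℕ i)) σ)
      (λ {τ} {τ′} τ≈τ′ → inS-resp-≈ {i = i} {σ} τ {τ′} {σ} τ≈τ′ (λ _ → refl)) (insert zero i)
      (λ π avoids → inS⁺ {i = i} {σ} (insert zero i π) refl avoids)
      (λ π ρ _ _ eq → proj₂ (insert-injective {i = i} {i} {π} {ρ} eq)))

cardS-resp-≈ : ∀ n r (σ σ′ : Permutation′ k) → σ ≈ σ′ → cardS n r σ ≡ cardS n r σ′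
cardS-resp-≈ n r σ σ′ σ≈σ′ = count-cong (inS? n r σ) (inS? n r σ′)
  (λ τ (head≡ , avoids) → head≡ , avoids-resp-≈ {τ = τ} {τ} {σ} {σ′} (λ _ → refl) σ≈σ′ avoids)
  (λ τ (head≡ , avoids) → head≡ ,
    avoids-resp-≈ {τ = τ} {τ} {σ′} {σ} (λ _ → refl) (sym ∘ σ≈σ′) avoids)

module _ (π : Permutation′ n) (σ σ′ : Permutation′ k) where

  -- An occurrence of σ′ in the complement of π becomes, after complementing once more, an
  -- occurrence of σ in π. The lemmas for reversal and inverse use the same involution argument.
  avoids-complement : σ′ ∘ₚ reverse ≈ σ → Avoids π σ → Avoids (π ∘ₚ reverse) σ′
  avoids-complement σ′ᶜ≈σ avoids = avoids
    ∘ contains-resp-≈ {τ = (π ∘ₚ reverse) ∘ₚ reverse} {π} {σ′ ∘ₚ reverse} {σ}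
        (λ _ → Fin.opposite-involutive _) σ′ᶜ≈σ
    ∘ contains-complement (π ∘ₚ reverse) σ′

  avoids-reverse : reverse ∘ₚ σ′ ≈ σ → Avoids π σ → Avoids (reverse ∘ₚ π) σ′
  avoids-reverse σ′ʳ≈σ avoids = avoids
    ∘ contains-resp-≈ {τ = reverse ∘ₚ (reverse ∘ₚ π)} {π} {reverse ∘ₚ σ′} {σ}
        (λ _ → cong (π ⟨$⟩ʳ_) (Fin.opposite-involutive _)) σ′ʳ≈σ
    ∘ contains-reverse (reverse ∘ₚ π) σ′

  avoids-flip : flip σ′ ≈ σ → Avoids π σ → Avoids (flip π) σ′
  avoids-flip σ′⁻¹≈σ avoids = avoids
    ∘ contains-resp-≈ {τ = flip (flip π)} {π} {flip σ′} {σ} (λ _ → refl) σ′⁻¹≈σ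
    ∘ contains-flip (flip π) σ′

module _ (π ρ : Permutation′ n) where

  complement-injective : π ∘ₚ reverse ≈ ρ ∘ₚ reverse → π ≈ ρ
  complement-injective eq x = ⟨$⟩ʳ-injective reverse (eq x)

  reverse-injective : reverse ∘ₚ π ≈ reverse ∘ₚ ρ → π ≈ ρ
  reverse-injective eq x =
    subst (λ y → π ⟨$⟩ʳ y ≡ ρ ⟨$⟩ʳ y) (Fin.opposite-involutive x) (eq (opposite x))

  flip-injective : flip π ≈ flip ρ → π ≈ ρ
  flip-injective eq x = trans (cong (π ⟨$⟩ʳ_) (trans (sym (inverseˡ ρ)) (sym (eq _)))) (inverseʳ π)

cardS-complement-≤ : (i : Fin (suc n)) (σ σ′ : Permutation′ k) → σ′ ∘ₚ reverse ≈ σ →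
  cardS (suc n) (suc (toℕ i)) σ ≤ cardS (suc n) (suc (toℕ (opposite i))) σ′
cardS-complement-≤ {n} i σ σ′ σ′ᶜ≈σ =
  count-≤ (inS? (suc n) (suc (toℕ i)) σ) (inS? (suc n) (suc (toℕ (opposite i))) σ′)
    (λ {τ} {τ′} τ≈τ′ → inS-resp-≈ {i = opposite i} {σ′} τ {τ′} {σ′} τ≈τ′ (λ _ → refl))
    (_∘ₚ reverse)
    (λ τ τ∈S@(_ , avoids) → inS⁺ {i = opposite i} {σ′} (τ ∘ₚ reverse)
      (cong opposite (inS-head {i = i} {σ} τ τ∈S)) (avoids-complement τ σ σ′ σ′ᶜ≈σ avoids))
    (λ τ τ′ _ _ → complement-injective τ τ′)

cardS-complement : (i : Fin (suc n)) (σ σ′ : Permutation′ k) → σ′ ∘ₚ reverse ≈ σ →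
  cardS (suc n) (suc (toℕ i)) σ ≡ cardS (suc n) (suc (toℕ (opposite i))) σ′
cardS-complement {n} i σ σ′ σ′ᶜ≈σ = ℕ.≤-antisym (cardS-complement-≤ i σ σ′ σ′ᶜ≈σ)
  -- The other inequality is the first one for `opposite i` with the patterns exchanged.
  (subst (λ j → cardS (suc n) (suc (toℕ (opposite i))) σ′ ≤ cardS (suc n) (suc (toℕ j)) σ)
    (Fin.opposite-involutive i)
    (cardS-complement-≤ (opposite i) σ′ σ λ x →
      trans (cong opposite (sym (σ′ᶜ≈σ x))) (Fin.opposite-involutive _)))

cardFrom-complement : (i : Fin (suc n)) (σ σ′ : Permutation′ k) → σ′ ∘ₚ reverse ≈ σ →
  cardFrom i σ ≡ cardFrom (opposite i) σ′
cardFrom-complement i σ σ′ σ′ᶜ≈σ = trans (sym (cardS≡cardFrom i σ))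
  (trans (cardS-complement i σ σ′ σ′ᶜ≈σ) (cardS≡cardFrom (opposite i) σ′))

cardFrom-321≡312 : ∀ n (i : Fin (suc n)) → cardFrom i s321 ≡ cardFrom i s312
cardFrom-321≡312 n i = begin
  cardFrom i s321             ≡⟨ cardFrom-complement i s321 s123
                                   (λ { 0F → refl ; 1F → refl ; 2F → refl }) ⟩
  cardFrom (opposite i) s123  ≡⟨ cardFrom-132≡123 n (opposite i) ⟨
  cardFrom (opposite i) s132  ≡⟨ cardFrom-complement i s312 s132
                                   (λ { 0F → refl ; 1F → refl ; 2F → refl }) ⟨
  cardFrom i s312             ∎
  where open ≡-Reasoning

-- The values below i come first, so π is a direct sum of permutations of sizes i and n - i.
-- Equivalently, the letter i put in front starts no 231.
Split : Fin (suc n) → Permutation′ n → Set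
Split i π = ∀ b c → b Fin.< c → i Fin.≤ (π ⟨$⟩ʳ b) → ¬ (π ⟨$⟩ʳ c) Fin.< i

module _ {i : Fin (suc n)} (π : Permutation′ n) (split : Split i π) where

  -- Each of the i values below i has its position before v, so there are at least i positions
  -- before v.
  split-≤ : ∀ {v} → i Fin.≤ (π ⟨$⟩ʳ v) → i Fin.≤ v
  split-≤ {v} i≤πv = Fin.injective⇒≤ {f = f} f-injective
    where
    i≤n : toℕ i ≤ n
    i≤n = Fin.toℕ≤pred[n] i
    value : Fin (toℕ i) → Fin n
    value x = inject≤ x i≤n
    value<i : ∀ x → value x Fin.< i
    value<i x = subst (_< toℕ i) (sym (Fin.toℕ-inject≤ x i≤n)) (Fin.toℕ<n x)
    position<v : ∀ x → (π ⟨$⟩ˡ value x) Fin.< v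
    position<v x with Fin.<-cmp (π ⟨$⟩ˡ value x) v
    ... | tri< lt _ _ = lt
    ... | tri≈ _ refl _ = contradiction (value<i x)
                            (ℕ.≤⇒≯ (subst (i Fin.≤_) (inverseʳ π) i≤πv))
    ... | tri> _ _ gt = contradiction (subst (Fin._< i) (sym (inverseʳ π)) (value<i x))
                            (split v _ gt i≤πv)
    f : Fin (toℕ i) → Fin (toℕ v)
    f x = fromℕ< (position<v x)
    f-injective : ∀ {x y} → f x ≡ f y → x ≡ y
    f-injective {x} {y} eq = Fin.inject≤-injective i≤n i≤n x y (⟨$⟩ʳ-injective (flip π)
      (Fin.toℕ-injective (Fin.fromℕ<-injective _ _ (position<v x) (position<v y) eq)))

  -- Every position up to u carries a value below i, so these u + 1 positions inject into the i
  -- values.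
  split-< : ∀ {u} → (π ⟨$⟩ʳ u) Fin.< i → u Fin.< i
  split-< {u} πu<i = Fin.injective⇒≤ {f = f} f-injective
    where
    u<n : suc (toℕ u) ≤ n
    u<n = Fin.toℕ<n u
    position : Fin (suc (toℕ u)) → Fin n
    position x = inject≤ x u<n
    position≤u : ∀ x → position x Fin.≤ u
    position≤u x = subst (_≤ toℕ u) (sym (Fin.toℕ-inject≤ x u<n)) (Fin.toℕ≤pred[n] x)
    value<i : ∀ x → (π ⟨$⟩ʳ position x) Fin.< i
    value<i x with Fin.<-cmp (position x) u
    ... | tri< lt _ _ = ℕ.≰⇒> λ i≤ → split _ u lt i≤ πu<i
    ... | tri≈ _ eq _ = subst (λ y → (π ⟨$⟩ʳ y) Fin.< i) (sym eq) πu<i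
    ... | tri> _ _ gt = contradiction gt (ℕ.≤⇒≯ (position≤u x))
    f : Fin (suc (toℕ u)) → Fin (toℕ i)
    f x = fromℕ< (value<i x)
    f-injective : ∀ {x y} → f x ≡ f y → x ≡ y
    f-injective {x} {y} eq = Fin.inject≤-injective u<n u<n x y (⟨$⟩ʳ-injective π
      (Fin.toℕ-injective (Fin.fromℕ<-injective _ _ (value<i x) (value<i y) eq)))

  -- The two previous lemmas say that π maps the first i positions onto the first i values. This
  -- condition is symmetric in positions and values, and it puts c below i and b at or above i,
  -- against b < c.
  split-flip : Split i (flip π)
  split-flip b c b<c i≤π⁻¹b π⁻¹c<i =
    ℕ.<⇒≱ b<c (ℕ.≤-trans (ℕ.<⇒≤ c<i) i≤b)
    where
    i≤b : i Fin.≤ b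
    i≤b = ℕ.≮⇒≥ λ b<i → ℕ.<⇒≱ (split-< (subst (Fin._< i) (sym (inverseʳ π)) b<i)) i≤π⁻¹b
    c<i : c Fin.< i
    c<i = ℕ.≰⇒> λ i≤c → ℕ.<⇒≱ π⁻¹c<i (split-≤ (subst (i Fin.≤_) (sym (inverseʳ π)) i≤c))

module _ (i : Fin (suc n)) (π : Permutation′ n) where

  -- Only the rest is transformed; the first letter stays i. Inside the rest, reversal turns 213
  -- into 312 and inversion turns 312 into 231. For occurrences using i, reversal produces a
  -- `Split`, which inversion preserves.
  avoids-213⇒231 : Avoids (insert zero i π) s213 → Avoids (insert zero i (flip (reverse ∘ₚ π))) s231
  avoids-213⇒231 avoids = avoids-insert s231 i (flip (reverse ∘ₚ π))
    (avoids-flip (reverse ∘ₚ π) s312 s231 (λ { 0F → refl ; 1F → refl ; 2F → refl })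
      (avoids-reverse π s213 s312 (λ { 0F → refl ; 1F → refl ; 2F → refl })
        (avoids ∘ contains-insert⁺ s213 i π)))
    λ starts → let b , c , b<c , i≤b , c<i = starts-231⁻ (flip (reverse ∘ₚ π)) starts in
      split-flip (reverse ∘ₚ π)
        (λ x y x<y i≤ <i → avoids (starts⇒contains-insert s213 i π
          (starts-213⁺ π (opposite-mono-< x<y) <i i≤)))
        b c b<c i≤b c<i

  avoids-231⇒213 : Avoids (insert zero i π) s231 → Avoids (insert zero i (reverse ∘ₚ flip π)) s213
  avoids-231⇒213 avoids = avoids-insert s213 i (reverse ∘ₚ flip π)
    (avoids-reverse (flip π) s312 s213 (λ { 0F → refl ; 1F → refl ; 2F → refl })
      (avoids-flip π s231 s312 (λ { 0F → refl ; 1F → refl ; 2F → refl })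
        (avoids ∘ contains-insert⁺ s231 i π)))
    λ starts → let b , c , b<c , b<i , i≤c = starts-213⁻ (reverse ∘ₚ flip π) starts in
      split-flip π
        (λ x y x<y i≤ <i → avoids (starts⇒contains-insert s231 i π (starts-231⁺ π x<y i≤ <i)))
        (opposite c) (opposite b) (opposite-mono-< b<c) i≤c b<i

-- Every later letter exceeds a minimal first letter. A pattern that begins with a descent therefore
-- cannot use it.
starts-zero : (π : Permutation′ n) → Starts σ zero π → (σ ⟨$⟩ʳ 0F) Fin.< (σ ⟨$⟩ʳ 1F)
starts-zero π (_ , _ , _ , ib , _) = to ib z≤n

-- No later letter exceeds a maximal first letter, so it is inert for patterns whose third letter
-- exceeds the first.
starts-max : (π : Permutation′ n) → Starts σ (fromℕ n) π → ¬ (σ ⟨$⟩ʳ 0F) Fin.< (σ ⟨$⟩ʳ 2F)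
starts-max π (_ , c , _ , _ , ic , _) σ0<σ2 = max≰ π c (from ic σ0<σ2)

module _ (i : Fin (suc n)) (σ σ′ : Permutation′ 3) (f : Permutation′ n → Permutation′ n)
         (f-injective : ∀ π ρ → f π ≈ f ρ → π ≈ ρ)
         (f-avoids : ∀ π → Avoids (insert zero i π) σ → Avoids (insert zero i (f π)) σ′) where
  opaque
    unfolding cardFrom

    cardFrom-≤ : cardFrom i σ ≤ cardFrom i σ′
    cardFrom-≤ = count-≤ (avoids-insert? i σ) (avoids-insert? i σ′)
      (λ {π} {ρ} → avoids-insert-resp-≈ i σ′ {π} {ρ}) f f-avoids (λ π ρ _ _ → f-injective π ρ)

cardFrom-213≡231 : ∀ n (i : Fin (suc n)) → cardFrom i s213 ≡ cardFrom i s231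
cardFrom-213≡231 n i = ℕ.≤-antisym
  (cardFrom-≤ i s213 s231 (λ π → flip (reverse ∘ₚ π))
    (λ π ρ → reverse-injective π ρ ∘ flip-injective (reverse ∘ₚ π) (reverse ∘ₚ ρ))
    (avoids-213⇒231 i))
  (cardFrom-≤ i s231 s213 (λ π → reverse ∘ₚ flip π)
    (λ π ρ → flip-injective π ρ ∘ reverse-injective (flip π) (flip ρ))
    (avoids-231⇒213 i))

cardFrom-zero-213≡312 : ∀ n → cardFrom {n} zero s213 ≡ cardFrom {n} zero s312
cardFrom-zero-213≡312 n = ℕ.≤-antisym
  (cardFrom-≤ zero s213 s312 (reverse ∘ₚ_) reverse-injective λ π avoids →
    avoids-insert s312 zero (reverse ∘ₚ π)
      (avoids-reverse π s213 s312 (λ { 0F → refl ; 1F → refl ; 2F → refl })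
        (avoids ∘ contains-insert⁺ s213 zero π))
      (λ starts → contradiction (starts-zero {σ = s312} (reverse ∘ₚ π) starts) λ ()))
  (cardFrom-≤ zero s312 s213 (reverse ∘ₚ_) reverse-injective λ π avoids →
    avoids-insert s213 zero (reverse ∘ₚ π)
      (avoids-reverse π s312 s213 (λ { 0F → refl ; 1F → refl ; 2F → refl })
        (avoids ∘ contains-insert⁺ s312 zero π))
      (λ starts → contradiction (starts-zero {σ = s213} (reverse ∘ₚ π) starts) λ ()))

-- Inequivalence

module _ {a b : Fin k} (a<b : a Fin.< b) (σ : Permutation′ k) where

  id-avoids : (σ ⟨$⟩ʳ b) Fin.< (σ ⟨$⟩ʳ a) → Avoids (id {n}) σ
  id-avoids σb<σa (ι , mono , iso) = ℕ.<-asym (to (iso a b a<b) (mono a<b)) σb<σa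

  reverse-avoids : (σ ⟨$⟩ʳ a) Fin.< (σ ⟨$⟩ʳ b) → Avoids (reverse {n}) σ
  reverse-avoids σa<σb (ι , mono , iso) =
    ℕ.<-asym (from (iso a b a<b) σa<σb) (opposite-mono-< (mono a<b))

increasing⇒inflationary : (f : Fin n → Fin n) → f Preserves Fin._<_ ⟶ Fin._<_ → ∀ x → x Fin.≤ f x
increasing⇒inflationary {suc n} f mono = <-weakInduction (λ x → x Fin.≤ f x) z≤n λ x x≤fx →
  ℕ.≤-<-trans (subst (_≤ toℕ (f (inject₁ x))) (Fin.toℕ-inject₁ x) x≤fx)
              (mono (ℕ.≤-reflexive (cong suc (Fin.toℕ-inject₁ x))))

-- Both π and its inverse are increasing, hence inflationary, which bounds π(x) by x from both
-- sides.
increasing⇒id : (π : Permutation′ n) → (π ⟨$⟩ʳ_) Preserves Fin._<_ ⟶ Fin._<_ → ∀ x → π ⟨$⟩ʳ x ≡ x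
increasing⇒id π mono x = Fin.toℕ-injective (ℕ.≤-antisym
  (subst ((π ⟨$⟩ʳ x) Fin.≤_) (inverseˡ π) (increasing⇒inflationary (π ⟨$⟩ˡ_) mono⁻¹ (π ⟨$⟩ʳ x)))
  (increasing⇒inflationary (π ⟨$⟩ʳ_) mono x))
  where
  mono⁻¹ : (π ⟨$⟩ˡ_) Preserves Fin._<_ ⟶ Fin._<_
  mono⁻¹ {x} {y} x<y with Fin.<-cmp (π ⟨$⟩ˡ x) (π ⟨$⟩ˡ y)
  ... | tri< lt _ _ = lt
  ... | tri≈ _ eq _ = contradiction (cong toℕ (⟨$⟩ʳ-injective (flip π) eq)) (ℕ.<⇒≢ x<y)
  ... | tri> _ _ gt =
    contradiction (subst₂ Fin._<_ (inverseʳ π) (inverseʳ π) (mono gt)) (ℕ.<-asym x<y)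

-- A descent after the maximal first letter would complete a 321.
avoids-321-max⇒increasing : (π : Permutation′ n) → Avoids (insert zero (fromℕ n) π) s321 →
                            (π ⟨$⟩ʳ_) Preserves Fin._<_ ⟶ Fin._<_
avoids-321-max⇒increasing π avoids {x} {y} x<y with Fin.<-cmp (π ⟨$⟩ʳ x) (π ⟨$⟩ʳ y)
... | tri< lt _ _ = lt
... | tri≈ _ eq _ = contradiction (cong toℕ (⟨$⟩ʳ-injective π eq)) (ℕ.<⇒≢ x<y)
... | tri> _ _ gt = contradiction
  (starts⇒contains-insert s321 _ π (starts-321⁺ π x<y (ℕ.≰⇒> (max≰ π x)) gt)) avoids

module _ (i : Fin (suc n)) (σ : Permutation′ 3) where
  opaque
    unfolding cardFrom

    cardFrom≤1 : (∀ π ρ → Avoids (insert zero i π) σ → Avoids (insert zero i ρ) σ → π ≈ ρ) →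
                 cardFrom i σ ≤ 1
    cardFrom≤1 = count-≤1 (avoids-insert? i σ)

    cardFrom≥2 : ∀ π ρ → Avoids (insert zero i π) σ → Avoids (insert zero i ρ) σ → ¬ π ≈ ρ →
                 2 ≤ cardFrom i σ
    cardFrom≥2 = count-≥2 (avoids-insert? i σ) (λ {π} {ρ} → avoids-insert-resp-≈ i σ {π} {ρ})

cardFrom-max-321≤1 : ∀ n → cardFrom (fromℕ n) s321 ≤ 1
cardFrom-max-321≤1 n = cardFrom≤1 (fromℕ n) s321 λ π ρ π-avoids ρ-avoids x →
  trans (increasing⇒id π (avoids-321-max⇒increasing π π-avoids) x)
        (sym (increasing⇒id ρ (avoids-321-max⇒increasing ρ ρ-avoids) x))

-- The maximal first letter is inert, because the third letter of the pattern exceeds its first. The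
-- rest may then be increasing, as the pattern has a descent, or decreasing, as it has an ascent;
-- the rest has at least two letters, so these differ.
cardFrom-max≥2 : ∀ n (σ : Permutation′ 3) {a b c d : Fin 3} →
  (σ ⟨$⟩ʳ 0F) Fin.< (σ ⟨$⟩ʳ 2F) →
  a Fin.< b → (σ ⟨$⟩ʳ a) Fin.< (σ ⟨$⟩ʳ b) →
  c Fin.< d → (σ ⟨$⟩ʳ d) Fin.< (σ ⟨$⟩ʳ c) →
  2 ≤ cardFrom (fromℕ (suc (suc n))) σ
cardFrom-max≥2 n σ σ0<σ2 a<b σa<σb c<d σd<σc = cardFrom≥2 (fromℕ (suc (suc n))) σ id reverse
  (avoids-insert σ (fromℕ (suc (suc n))) id (id-avoids c<d σ σd<σc)
    λ starts → starts-max {σ = σ} id starts σ0<σ2)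
  (avoids-insert σ (fromℕ (suc (suc n))) reverse (reverse-avoids a<b σ σa<σb)
    λ starts → starts-max {σ = σ} reverse starts σ0<σ2)
  (λ id≈reverse → contradiction (id≈reverse zero) λ ())

-- The first letter is the second largest of all, so only the maximum exceeds it. Any smaller letter
-- before the maximum would complete a 213.
head≡max-213 : (π : Permutation′ (suc n)) → Avoids (insert zero (inject₁ (fromℕ n)) π) s213 →
               π ⟨$⟩ʳ zero ≡ fromℕ n
head≡max-213 {n} π avoids with (π ⟨$⟩ʳ zero) Fin.≟ fromℕ n
... | yes π0≡max = π0≡max
... | no  π0≢max = contradiction
  (starts⇒contains-insert s213 _ π (starts-213⁺ π {zero} {π ⟨$⟩ˡ fromℕ n}
    (≢0⇒> λ eq → π0≢max (trans (cong (π ⟨$⟩ʳ_) (sym eq)) (inverseʳ π)))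
    (subst (toℕ (π ⟨$⟩ʳ zero) <_) (sym toℕ-i) (≢fromℕ⇒< _ π0≢max))
    (ℕ.≤-reflexive (trans toℕ-i (cong toℕ (sym (inverseʳ π)))))))
  avoids
  where
  toℕ-i : toℕ (inject₁ (fromℕ n)) ≡ toℕ (fromℕ n)
  toℕ-i = Fin.toℕ-inject₁ (fromℕ n)

module _ (n : ℕ) where
  private
    i : Fin (suc (suc (suc n)))
    i = inject₁ (fromℕ (suc n))

    max : Fin (suc (suc n))
    max = fromℕ (suc n)

    -- The reverse complement turns 213 into 132. By `head≡max-213` the first letter of π carries no
    -- information, so `f` may discard it and put the maximum back.
    g : Permutation′ (suc (suc n)) → Permutation′ (suc n)
    g π = (reverse ∘ₚ remove zero π) ∘ₚ reverse

    f : Permutation′ (suc (suc n)) → Permutation′ (suc (suc n))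
    f π = insert zero max (g π)

    ¬starts-132 : (π : Permutation′ (suc (suc n))) → ¬ Starts s132 i π
    -- An occurrence would need two letters above the second largest.
    ¬starts-132 π starts = let b , c , _ , i≤πc , πc<πb = starts-132⁻ π starts in
      fromℕ-maximum (π ⟨$⟩ʳ b) (ℕ.≤-<-trans
        (subst (_≤ toℕ (π ⟨$⟩ʳ c)) (Fin.toℕ-inject₁ max) i≤πc) πc<πb)

    f-avoids : ∀ π → Avoids (insert zero i π) s213 → Avoids (insert zero i (f π)) s132
    f-avoids π avoids = avoids-insert s132 i (f π)
      (avoids-insert s132 max (g π)
        (avoids-complement (reverse ∘ₚ remove zero π) s312 s132
          (λ { 0F → refl ; 1F → refl ; 2F → refl })
          (avoids-reverse (remove zero π) s213 s312 (λ { 0F → refl ; 1F → refl ; 2F → refl })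
            (avoids ∘ contains-insert⁺ s213 i π
                    ∘ contains-resp-≈ {τ = insert zero (π ⟨$⟩ʳ zero) (remove zero π)} {π} {s213} {s213}
                        (insert-remove zero π) (λ _ → refl)
                    ∘ contains-insert⁺ s213 (π ⟨$⟩ʳ zero) (remove zero π))))
        λ starts → starts-max {σ = s132} (g π) starts z<s)
      (¬starts-132 (f π))

    f-injective : ∀ π ρ → Avoids (insert zero i π) s213 → Avoids (insert zero i ρ) s213 →
                  f π ≈ f ρ → π ≈ ρ
    f-injective π ρ π-avoids ρ-avoids eq x = trans
      (sym (insert-remove-head π (head≡max-213 π π-avoids) x)) (trans
      (insert-cong {i = max} {π = remove zero π} {remove zero ρ} refl tails x)
      (insert-remove-head ρ (head≡max-213 ρ ρ-avoids) x))
      where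
      tails : remove zero π ≈ remove zero ρ
      tails = reverse-injective (remove zero π) (remove zero ρ)
        (complement-injective (reverse ∘ₚ remove zero π) (reverse ∘ₚ remove zero ρ)
          (proj₂ (insert-injective {i = max} {max} {g π} {g ρ} eq)))

  opaque
    unfolding cardFrom

    -- The strictness comes from id, which is not of the form f π: its first letter is minimal.
    cardFrom-213<132 : cardFrom i s213 < cardFrom i s132
    cardFrom-213<132 = count-< (avoids-insert? i s213) (avoids-insert? i s132)
      (λ {π} {ρ} → avoids-insert-resp-≈ i s132 {π} {ρ}) f f-avoids f-injective
      id
      (avoids-insert s132 i id (id-avoids {a = 1F} {2F} (s<s z<s) s132 (s<s z<s)) (¬starts-132 id))
      (λ π _ id≈fπ → contradiction (id≈fπ zero) λ ())

wilf⁺ : (σ : Permutation′ k) (σ′ : Permutation′ l) →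
        (∀ n (i : Fin (suc n)) → toℕ i ≡ r → cardFrom i σ ≡ cardFrom i σ′) →
        WilfEquivalent (suc r) σ σ′
wilf⁺ {r = r} σ σ′ eqs (suc n) (s≤s r≤n) =
  subst (λ j → cardS (suc n) (suc j) σ ≡ cardS (suc n) (suc j) σ′) toℕ-i
    (trans (cardS≡cardFrom i σ) (trans (eqs n i toℕ-i) (sym (cardS≡cardFrom i σ′))))
  where
  i : Fin (suc n)
  i = fromℕ< (s≤s r≤n)
  toℕ-i : toℕ i ≡ r
  toℕ-i = Fin.toℕ-fromℕ< (s≤s r≤n)

wilf⁻ : (σ : Permutation′ k) (σ′ : Permutation′ l) (i : Fin (suc n)) → toℕ i ≡ r →
        WilfEquivalent (suc r) σ σ′ → cardFrom i σ ≡ cardFrom i σ′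
wilf⁻ σ σ′ i refl σ~σ′ = trans (sym (cardS≡cardFrom i σ))
  (trans (σ~σ′ _ (Fin.toℕ<n i)) (cardS≡cardFrom i σ′))

¬wilf-213-132 : ∀ r → ¬ WilfEquivalent (suc (suc r)) s213 s132
¬wilf-213-132 r 213~132 = ℕ.<⇒≢ (cardFrom-213<132 r)
  (wilf⁻ s213 s132 (inject₁ (fromℕ (suc r)))
    (trans (Fin.toℕ-inject₁ (fromℕ (suc r))) (Fin.toℕ-fromℕ (suc r))) 213~132)

¬wilf-max : ∀ r (σ : Permutation′ 3) → 2 ≤ cardFrom (fromℕ (suc (suc r))) σ →
            ¬ WilfEquivalent (suc (suc (suc r))) σ s321
¬wilf-max r σ 2≤ σ~321 = ℕ.<⇒≱ 2≤
  (subst (_≤ 1) (sym (wilf⁻ σ s321 max (Fin.toℕ-fromℕ (suc (suc r))) σ~321)) (cardFrom-max-321≤1 _))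
  where
  max = fromℕ (suc (suc r))

¬wilf-213-321 : ∀ r → ¬ WilfEquivalent (suc (suc r)) s213 s321
-- For r = 2 and n = 3, only 231 avoids 213, while both 213 and 231 avoid 321.
¬wilf-213-321 zero    213~321 = contradiction (213~321 3 (s≤s (s≤s z≤n))) λ ()
¬wilf-213-321 (suc r) = ¬wilf-max r s213
  (cardFrom-max≥2 r s213 {0F} {2F} {0F} {1F} (s<s z<s) z<s (s<s z<s) z<s z<s)

¬wilf-132-321 : ∀ r → ¬ WilfEquivalent (suc (suc r)) s132 s321
-- For r = 2 both counts are 2 at n = 3; at n = 4 they are 3 and 5.
¬wilf-132-321 zero    132~321 = contradiction (132~321 4 (s≤s (s≤s z≤n))) λ ()
¬wilf-132-321 (suc r) = ¬wilf-max r s132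
  (cardFrom-max≥2 r s132 {0F} {2F} {1F} {2F} z<s z<s z<s (s<s z<s) (s<s z<s))

-- Equivalence classes

module _ {A : Set} {_~_ : Rel A 0ℓ} (isEquivalence : IsEquivalence _~_) where

  private
    module ~ = IsEquivalence isEquivalence

  private variable
    x y : A
    xs zs : List A
    C D : Pred A 0ℓ
    Cs Ds : List (Pred A 0ℓ)

  -- That C exhausts the class of x is not demanded here; it follows once C belongs to a covering
  -- family with pairwise unrelated representatives.
  Represents : A → Pred A 0ℓ → Set
  Represents x C = C x × (∀ y → C y → x ~ y)

  private
    ¬rep~ : Pointwise Represents xs Cs → All (λ z → ¬ x ~ z) xs →
            Any (λ C → C y) Cs → ¬ x ~ y
    ¬rep~ ((_ , rep~) ∷ _) (x≁z ∷ _)  (here y∈C)   x~y = x≁z (~.trans x~y (~.sym (rep~ _ y∈C)))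
    ¬rep~ (_ ∷ reps)       (_ ∷ x≁zs) (there y∈Cs) x~y = ¬rep~ reps x≁zs y∈Cs x~y

    unrelated : Pointwise Represents xs Cs → x ~ y → All (λ z → ¬ x ~ z) xs →
                Pointwise (λ z C → z ~ y → C y) xs Cs
    unrelated []         x~y []           = []
    unrelated (_ ∷ reps) x~y (x≁z ∷ x≁zs) =
      (λ z~y → contradiction (~.trans x~y (~.sym z~y)) x≁z) ∷ unrelated reps x~y x≁zs

    -- The element y lies in some listed set. At that entry the claim is immediate; at every other
    -- entry y is unrelated to the representative, so the claim is vacuous.
    rep~⁻ : Pointwise Represents xs Cs → AllPairs (λ x z → ¬ x ~ z) xs →
            ∀ y → Any (λ C → C y) Cs → Pointwise (λ x C → x ~ y → C y) xs Cs
    rep~⁻ ((_ , rep~) ∷ reps) (x≁zs ∷ _)    y (here y∈C)   =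
      (λ _ → y∈C) ∷ unrelated reps (rep~ y y∈C) x≁zs
    rep~⁻ (_ ∷ reps)          (x≁zs ∷ sep) y (there y∈Cs) =
      (λ x~y → contradiction x~y (¬rep~ reps x≁zs y∈Cs)) ∷ rep~⁻ reps sep y y∈Cs

    classes : Pointwise Represents xs Cs →
              (∀ y → Pointwise (λ x C → x ~ y → C y) xs Cs) →
              Pointwise (λ x C → C ≐ (x ~_)) xs Cs
    classes []                  _     = []
    classes ((_ , rep~) ∷ reps) rep~⁻ =
      ((λ {y} → rep~ y) , (λ {y} → Pointwise.head (rep~⁻ y))) ∷
      classes reps (Pointwise.tail ∘ rep~⁻)

    isClass : Pointwise (λ x C → C ≐ (x ~_)) xs Cs → All (IsClass _~_) Cs
    isClass []           = []
    isClass (C≐x~ ∷ C≐s) = (_ , C≐x~) ∷ isClass C≐s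

    class-of : Pointwise (λ z C → C ≐ (z ~_)) xs Cs → D ≐ (x ~_) →
               Any (λ C → C x) Cs → Any (D ≐_) Cs
    class-of ((C⊆ , ⊆C) ∷ _) (D⊆ , ⊆D) (here x∈C) = here
      ( (λ y∈D → ⊆C (~.trans (C⊆ x∈C) (D⊆ y∈D)))
      , (λ y∈C → ⊆D (~.trans (~.sym (C⊆ x∈C)) (C⊆ y∈C))))
    class-of (_ ∷ C≐s) D≐x~ (there x∈Cs) = there (class-of C≐s D≐x~ x∈Cs)

    distinct : Pointwise (λ x C → C ≐ (x ~_)) xs Cs →
               AllPairs (λ x z → ¬ x ~ z) xs → AllPairs (λ C D → ¬ C ≐ D) Cs
    distinct []                 []           = []
    distinct ((C⊆ , ⊆C) ∷ C≐s) (x≁zs ∷ sep) = go C≐s x≁zs ∷ distinct C≐s sep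
      where
      go : Pointwise (λ z D → D ≐ (z ~_)) zs Ds → All (λ z → ¬ _ ~ z) zs →
           All (λ D → ¬ _ ≐ D) Ds
      go []                []           = []
      go ((_ , ⊆D) ∷ D≐s) (x≁z ∷ x≁zs) =
        (λ (_ , D⊆C) → x≁z (C⊆ (D⊆C (⊆D ~.refl)))) ∷ go D≐s x≁zs

  partition⇒classesAre : Pointwise Represents xs Cs →
    AllPairs (λ x z → ¬ x ~ z) xs → (∀ y → Any (λ C → C y) Cs) → ClassesAre _~_ Cs
  partition⇒classesAre reps separate cover =
    isClass C≐s , (λ D (x , D≐x~) → class-of C≐s D≐x~ (cover x)) , distinct C≐s separate
    where
    C≐s = classes reps (λ y → rep~⁻ reps separate y (cover y))

wilf-isEquivalence : ∀ r → IsEquivalence (WilfEquivalent {3} {3} r)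
wilf-isEquivalence r = record
  { refl  = λ _ _ → refl
  ; sym   = λ σ~σ′ n r≤n → sym (σ~σ′ n r≤n)
  ; trans = λ σ~σ′ σ′~σ″ n r≤n → trans (σ~σ′ n r≤n) (σ′~σ″ n r≤n)
  }

oneLine-cong : (σ σ′ : Permutation′ 3) → σ ≈ σ′ → oneLine σ ≡ oneLine σ′
oneLine-cong σ σ′ σ≈σ′ = tabulate-cong (λ i → cong (suc ∘ toℕ) (σ≈σ′ i))

oneLine-injective : (σ σ′ : Permutation′ 3) → oneLine σ ≡ oneLine σ′ → σ ≈ σ′
oneLine-injective σ σ′ eq i = Fin.toℕ-injective (ℕ.suc-injective (go i))
  where
  go : ∀ i → suc (toℕ (σ ⟨$⟩ʳ i)) ≡ suc (toℕ (σ′ ⟨$⟩ʳ i))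
  go 0F = ∷-injectiveˡ eq
  go 1F = ∷-injectiveˡ (∷-injectiveʳ eq)
  go 2F = ∷-injectiveˡ (∷-injectiveʳ (∷-injectiveʳ eq))

wilf-oneLine : ∀ r (ρ ρ′ σ : Permutation′ 3) →
  WilfEquivalent r ρ ρ′ → oneLine σ ≡ oneLine ρ′ → WilfEquivalent r ρ σ
wilf-oneLine r ρ ρ′ σ ρ~ρ′ eq n r≤n =
  trans (ρ~ρ′ n r≤n) (cardS-resp-≈ n r ρ′ σ (sym ∘ oneLine-injective σ ρ′ eq))

-- Every σ equals one of the six enumerated permutations up to `_≈_`, and `oneLine` respects `_≈_`,
-- so checking these six words suffices.
oneLine-cover : (Cs : List (List (List ℕ))) →
  All (λ w → Any (w ∈_) Cs) (map oneLine (permutations 3)) →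
  ∀ (σ : Permutation′ 3) → Any (λ C → C σ) (map ⟦_⟧ Cs)
oneLine-cover Cs all σ = Any.map⁺ (go (permutations-complete 3 σ) all)
  where
  go : ∀ {πs} → Any (σ ≈_) πs → All (λ w → Any (w ∈_) Cs) (map oneLine πs) → Any (oneLine σ ∈_) Cs
  go (here {x = π} σ≈π) (π∈ ∷ _)  = subst (λ w → Any (w ∈_) Cs) (sym (oneLine-cong σ π σ≈π)) π∈
  go (there σ∈)         (_ ∷ all) = go σ∈ all

wilf-132-123 : ∀ r → WilfEquivalent (suc r) s132 s123
wilf-132-123 r = wilf⁺ s132 s123 λ n i _ → cardFrom-132≡123 n i

wilf-321-312 : ∀ r → WilfEquivalent (suc r) s321 s312
wilf-321-312 r = wilf⁺ s321 s312 λ n i _ → cardFrom-321≡312 n i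

wilf-213-231 : ∀ r → WilfEquivalent (suc r) s213 s231
wilf-213-231 r = wilf⁺ s213 s231 λ n i _ → cardFrom-213≡231 n i

wilf₁-213-312 : WilfEquivalent 1 s213 s312
wilf₁-213-312 = wilf⁺ s213 s312 λ { n zero _ → cardFrom-zero-213≡312 n ; _ (suc _) () }

classes₁ : ClassesAre (WilfEquivalent {3} {3} 1)
  ( ⟦ p123 ∷ p132 ∷ [] ⟧
  ∷ ⟦ p321 ∷ p312 ∷ p213 ∷ p231 ∷ [] ⟧
  ∷ [])
classes₁ = partition⇒classesAre (wilf-isEquivalence 1) {xs = s132 ∷ s312 ∷ []}
  ((there (here refl) , 132~) ∷ (there (here refl) , 312~) ∷ [])
  ((¬wilf₁-132-312 ∷ []) ∷ [] ∷ [])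
  (oneLine-cover ((p123 ∷ p132 ∷ []) ∷ (p321 ∷ p312 ∷ p213 ∷ p231 ∷ []) ∷ [])
    -- Witnesses in the order of the enumeration: 123, 132, 213, 231, 312, 321.
    ( here (here refl) ∷ here (there (here refl)) ∷ there (here (there (there (here refl))))
    ∷ there (here (there (there (there (here refl))))) ∷ there (here (there (here refl)))
    ∷ there (here (here refl)) ∷ []))
  where
  open IsEquivalence (wilf-isEquivalence 1) renaming (refl to ~-refl; sym to ~-sym; trans to ~-trans)
  312~321 : WilfEquivalent 1 s312 s321
  312~321 = ~-sym {s321} {s312} (wilf-321-312 0)
  312~213 : WilfEquivalent 1 s312 s213
  312~213 = ~-sym {s213} {s312} wilf₁-213-312
  312~231 : WilfEquivalent 1 s312 s231
  312~231 = ~-trans {s312} {s213} {s231} 312~213 (wilf-213-231 0)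
  132~ : ∀ σ → oneLine {3} σ ∈ p123 ∷ p132 ∷ [] → WilfEquivalent 1 s132 σ
  132~ σ (here eq)         = wilf-oneLine 1 s132 s123 σ (wilf-132-123 0) eq
  132~ σ (there (here eq)) = wilf-oneLine 1 s132 s132 σ (~-refl {s132}) eq
  312~ : ∀ σ → oneLine {3} σ ∈ p321 ∷ p312 ∷ p213 ∷ p231 ∷ [] → WilfEquivalent 1 s312 σ
  312~ σ (here eq)                         = wilf-oneLine 1 s312 s321 σ 312~321 eq
  312~ σ (there (here eq))                 = wilf-oneLine 1 s312 s312 σ (~-refl {s312}) eq
  312~ σ (there (there (here eq)))         = wilf-oneLine 1 s312 s213 σ 312~213 eq
  312~ σ (there (there (there (here eq)))) = wilf-oneLine 1 s312 s231 σ 312~231 eq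
  ¬wilf₁-132-312 : ¬ WilfEquivalent 1 s132 s312
  -- Of 123 and 132, only the first avoids 132, but both avoid 312.
  ¬wilf₁-132-312 132~312 = contradiction (132~312 3 (s≤s z≤n)) λ ()

classes₂ : ∀ r → ClassesAre (WilfEquivalent {3} {3} (suc (suc r)))
  ( ⟦ p213 ∷ p231 ∷ [] ⟧
  ∷ ⟦ p123 ∷ p132 ∷ [] ⟧
  ∷ ⟦ p321 ∷ p312 ∷ [] ⟧
  ∷ [])
classes₂ r = partition⇒classesAre (wilf-isEquivalence r′) {xs = s213 ∷ s132 ∷ s321 ∷ []}
  ((here refl , 213~) ∷ (there (here refl) , 132~) ∷ (here refl , 321~) ∷ [])
  ((¬wilf-213-132 r ∷ ¬wilf-213-321 r ∷ []) ∷ (¬wilf-132-321 r ∷ []) ∷ [] ∷ [])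
  (oneLine-cover ((p213 ∷ p231 ∷ []) ∷ (p123 ∷ p132 ∷ []) ∷ (p321 ∷ p312 ∷ []) ∷ [])
    ( there (here (here refl)) ∷ there (here (there (here refl))) ∷ here (here refl)
    ∷ here (there (here refl)) ∷ there (there (here (there (here refl))))
    ∷ there (there (here (here refl))) ∷ []))
  where
  r′ : ℕ
  r′ = suc (suc r)
  open IsEquivalence (wilf-isEquivalence r′) renaming (refl to ~-refl)
  213~ : ∀ σ → oneLine {3} σ ∈ p213 ∷ p231 ∷ [] → WilfEquivalent r′ s213 σ
  213~ σ (here eq)         = wilf-oneLine r′ s213 s213 σ (~-refl {s213}) eq
  213~ σ (there (here eq)) = wilf-oneLine r′ s213 s231 σ (wilf-213-231 (suc r)) eq
  132~ : ∀ σ → oneLine {3} σ ∈ p123 ∷ p132 ∷ [] → WilfEquivalent r′ s132 σ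
  132~ σ (here eq)         = wilf-oneLine r′ s132 s123 σ (wilf-132-123 (suc r)) eq
  132~ σ (there (here eq)) = wilf-oneLine r′ s132 s132 σ (~-refl {s132}) eq
  321~ : ∀ σ → oneLine {3} σ ∈ p321 ∷ p312 ∷ [] → WilfEquivalent r′ s321 σ
  321~ σ (here eq)         = wilf-oneLine r′ s321 s321 σ (~-refl {s321}) eq
  321~ σ (there (here eq)) = wilf-oneLine r′ s321 s312 σ (wilf-321-312 (suc r)) eq

theorem7p1 : ClassesAre {Permutation′ 3} (WilfEquivalent 1)
    ( ⟦ p123 ∷ p132 ∷ [] ⟧
    ∷ ⟦ p321 ∷ p312 ∷ p213 ∷ p231 ∷ [] ⟧
    ∷ [])
    ×
    ((r : ℕ) → 2 ≤ r →
    ClassesAre {Permutation′ 3} (WilfEquivalent r)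
    ( ⟦ p213 ∷ p231 ∷ [] ⟧
    ∷ ⟦ p123 ∷ p132 ∷ [] ⟧
    ∷ ⟦ p321 ∷ p312 ∷ [] ⟧
    ∷ []))
theorem7p1 = classes₁ , λ { (suc (suc r)) (s≤s (s≤s z≤n)) → classes₂ r }
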